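{- Let $p$ be a prime and, for a nonzero integer $a$, let $v(a)$ denote the exponent of $p$ in the prime factorization of $a$. Let $f,g\in\mathbb{Z}[x]$ be monic polynomials with nonzero resultant $r$. Let $s$ be an integer with $0\le s\le p$ and assume that $p^s$ divides both $f(n)$ and $g(n)$ for all $n\in\mathbb{Z}$. Let $$S=\max_{n\in\mathbb{Z}} v(\gcd(f(n),g(n))).$$ Then: (a) $v(r)-S\ge ps^2-s$. (b) If $v(r)-S=ps^2-s$, then the function $n\mapsto v(\gcd(f(n),g(n)))$ on $\mathbb{Z}$ takes every integer value in the interval $[s,S]$.
   Context: The resultant of $f$ and $g$ is the determinant of their Sylvester matrix (equivalently $\prod_{i,j}(\gamma_i-\delta_j)$ over the roots $\gamma_i$ of $f$ and $\delta_j$ of $g$ counted with multiplicity). -}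

module Defs where

open import Data.Nat as ℕ using (ℕ; zero; suc; _≤?_; _<?_)
open import Data.Fin using (Fin; toℕ; fromℕ<; punchIn)
open import Data.Integer using (ℤ; +_; -_; _+_; _*_; _^_; 0ℤ; 1ℤ)
open import Data.Integer.Divisibility using (_∣_)
open import Relation.Nullary using (¬_; yes; no)

sumFin : (n : ℕ) → (Fin n → ℤ) → ℤ
sumFin zero    f = 0ℤ
sumFin (suc n) f = f Data.Fin.zero + sumFin n (λ i → f (Data.Fin.suc i))

sign : ℕ → ℤ
sign zero          = 1ℤ
sign (suc zero)    = - 1ℤ
sign (suc (suc k)) = sign k

det : (n : ℕ) → (Fin n → Fin n → ℤ) → ℤ
det zero    M = 1ℤ
det (suc n) M =
  sumFin (suc n) (λ j → sign (toℕ j) * (M Data.Fin.zero j *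
    det n (λ k l → M (Data.Fin.suc k) (punchIn j l))))

-- A monic polynomial of degree m in ℤ[x] is given by its lower coefficients
-- a₀ … a_{m-1}:  x^m + a_{m-1} x^{m-1} + … + a₀.
-- k-th coefficient (as a function of k : ℕ, zero above the degree).
coeff : (m : ℕ) → (Fin m → ℤ) → ℕ → ℤ
coeff m a k with k <? m
... | yes k<m = a (fromℕ< k<m)
... | no _ with k ℕ.≟ m
...   | yes _ = 1ℤ
...   | no _  = 0ℤ

eval : (m : ℕ) → (Fin m → ℤ) → ℤ → ℤ
eval m a x = sumFin (suc m) (λ k → coeff m a (toℕ k) * (x ^ toℕ k))

-- Entry in column j of a Sylvester row holding the coefficients of a degree-d
-- polynomial (highest first) shifted right by t.
sylRow : (c : ℕ → ℤ) (d t j : ℕ) → ℤ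
sylRow c d t j with t ≤? j
... | no _ = 0ℤ
... | yes _ with (j ℕ.∸ t) ≤? d
...   | yes _ = c (d ℕ.∸ (j ℕ.∸ t))
...   | no _  = 0ℤ

sylvester : (m n : ℕ) → (Fin m → ℤ) → (Fin n → ℤ) → Fin (m ℕ.+ n) → Fin (m ℕ.+ n) → ℤ
sylvester m n a b i j with toℕ i <? n
... | yes _ = sylRow (coeff m a) m (toℕ i) (toℕ j)
... | no _  = sylRow (coeff n b) n (toℕ i ℕ.∸ n) (toℕ j)

resultant : (m n : ℕ) → (Fin m → ℤ) → (Fin n → ℤ) → ℤ
resultant m n a b = det (m ℕ.+ n) (sylvester m n a b)

-- p-adic valuation of an integer, as a relation: v_p(a) = k  iff
-- p^k ∣ a and p^(k+1) ∤ a  (holds for no k when a = 0).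
record IsVal (p : ℕ) (a : ℤ) (k : ℕ) : Set where
  field
    pow-dvd : + (p ℕ.^ k) ∣ a
    not-dvd : ¬ (+ (p ℕ.^ suc k) ∣ a)

{-# OPTIONS --safe #-}
module Submission where

-- Let f[e_a, …, e_b] denote divided differences. Replacing the powers of x by Newton polynomials
-- (x - e_0)⋯(x - e_(k-1)), both in the rows x^a f, x^a g and in the columns of the Sylvester
-- matrix, is unimodular; the new entries are f[e_a, …, e_b] and g[e_a, …, e_b], zero for b < a.
-- If e_t ≡ e_0 + t mod p, then p^(s - ⌊d/p⌋) divides f[e_a, …, e_(a+d)], because s ≤ p.
-- Giving column b the weight 2s - ⌊b/p⌋ and row a the weight s - ⌊a/p⌋ (truncated at 0), the
-- entry has valuation at least column weight minus row weight, and summing the weights gives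
-- v(r) ≥ p s². Column 0 contains only f(e_0) and g(e_0), so if the maximum S is attained at e_0
-- then its weight can be raised by S - s: this is (a).
-- For (b), with s ≤ k < S, take e_p = x = e_0 + p^(k-s+1) (for s = 0: e_1 = x = e_0 + p^k).
-- Then p^k divides f(x) and g(x); if p^(k+1) did too, then the weight of the column of x could
-- be raised by 1, and the bound in (a) would be strict.

open import Defs
open import Data.Nat using (ℕ; _≤_)
open import Data.Nat.Primality using (Prime)
open import Data.Fin using (Fin)
open import Data.Integer using (ℤ; +_; _-_; 0ℤ) renaming (_≤_ to _≤ℤ_; _*_ to _*ℤ_)
open import Data.Integer.Divisibility using (_∣_)
open import Data.Integer.GCD using (gcd)
open import Data.Product using (Σ; _×_)
open import Relation.Binary.PropositionalEquality using (_≡_; _≢_)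

open import Data.Nat as ℕ using (zero; suc; _<_; _∸_; z≤n; s≤s; _≤?_; _<?_; NonZero)
import Data.Nat.Properties as ℕ
open import Data.Nat.DivMod
  using (_/_; _%_; +-distrib-/-∣ʳ; n/n≡1; m<n⇒m/n≡0; 0/n≡0; /-monoˡ-≤; m*n/n≡m; m<n*o⇒m/o<n; m/n*n≤m; m≡m%n+[m/n]*n)
import Data.Nat.Divisibility as ℕ∣
open import Data.Nat.Primality using (euclidsLemma; prime⇒nonZero; prime⇒nonTrivial)
import Data.Nat.Tactic.RingSolver as ℕSolver
open import Data.Fin using (zero; suc; toℕ; punchIn; inject₁; fromℕ)
open import Data.Fin.Properties using (toℕ-inject₁; toℕ-fromℕ; toℕ<n)
open import Data.Integer using (-_; _+_; _*_; _^_; 1ℤ; ∣_∣; +≤+)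
import Data.Integer.Properties as ℤ
open import Data.Integer.Properties
  using (+-identityˡ; +-identityʳ; *-zeroʳ; *-identityʳ; *-assoc; *-distribˡ-+; pos-*; abs-*)
open import Data.Integer.Divisibility.Signed
  using (divides; ∣m∣n⇒∣m+n; ∣m∣n⇒∣m-n; ∣m+n∣m⇒∣n; ∣m+n∣n⇒∣m; ∣m⇒∣m*n; ∣n⇒∣m*n; ∣m⇒∣-m;
         *-monoʳ-∣; *-monoˡ-∣; *-cancelˡ-∣; *-cancelʳ-∣; ∣ᵤ⇒∣; ∣⇒∣ᵤ)
  renaming (_∣_ to _∣ₛ_; ∣-trans to ∣ₛ-trans; ∣-refl to ∣ₛ-refl)
open import Data.Integer.Tactic.RingSolver using (solve-∀)
open import Data.Integer.GCD using (gcd-greatest; gcd[i,j]∣i; gcd[i,j]∣j)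
open import Data.Product using (_,_; ∃)
open import Data.Sum using (_⊎_; inj₁; inj₂)
open import Data.Unit using (⊤; tt)
open import Function using (_∘_)
open import Relation.Nullary using (¬_; yes; no; contradiction)
open import Relation.Binary.PropositionalEquality
  using (refl; sym; trans; cong; cong₂; subst; subst₂; module ≡-Reasoning)
open ≡-Reasoning

-- Determinants

Matrix : ℕ → ℕ → Set
Matrix k l = Fin k → Fin l → ℤ

sum-cong : ∀ n {f g : Fin n → ℤ} → (∀ i → f i ≡ g i) → sumFin n f ≡ sumFin n g
sum-cong zero    h = refl
sum-cong (suc n) h = cong₂ _+_ (h zero) (sum-cong n (h ∘ suc))

sum-0 : ∀ n → sumFin n (λ _ → 0ℤ) ≡ 0ℤ
sum-0 zero    = refl
sum-0 (suc n) = trans (+-identityˡ _) (sum-0 n)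

sum-+ : ∀ n (f g : Fin n → ℤ) → sumFin n (λ i → f i + g i) ≡ sumFin n f + sumFin n g
sum-+ zero    f g = refl
sum-+ (suc n) f g = begin
  f zero + g zero + sumFin n (λ i → f (suc i) + g (suc i))
    ≡⟨ cong (_+_ (f zero + g zero)) (sum-+ n (f ∘ suc) (g ∘ suc)) ⟩
  f zero + g zero + (sumFin n (f ∘ suc) + sumFin n (g ∘ suc))
    ≡⟨ interchange (f zero) (g zero) (sumFin n (f ∘ suc)) (sumFin n (g ∘ suc)) ⟩
  f zero + sumFin n (f ∘ suc) + (g zero + sumFin n (g ∘ suc)) ∎
  where
  interchange : ∀ a b c d → a + b + (c + d) ≡ a + c + (b + d)
  interchange = solve-∀

sum-* : ∀ n c (f : Fin n → ℤ) → sumFin n (λ i → c * f i) ≡ c * sumFin n f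
sum-* zero    c f = sym (*-zeroʳ c)
sum-* (suc n) c f = trans (cong (_+_ (c * f zero)) (sum-* n c (f ∘ suc)))
                          (sym (*-distribˡ-+ c _ _))

sum-swap : ∀ k l (f : Matrix k l) →
  sumFin k (λ i → sumFin l (f i)) ≡ sumFin l (λ j → sumFin k (λ i → f i j))
sum-swap zero    l f = sym (sum-0 l)
sum-swap (suc k) l f = trans (cong (_+_ (sumFin l (f zero))) (sum-swap k l (f ∘ suc)))
                             (sym (sum-+ l _ _))

sign-suc : ∀ k → sign (suc k) ≡ - sign k
sign-suc zero          = refl
sign-suc (suc zero)    = refl
sign-suc (suc (suc k)) = sign-suc k

-- The determinant with first row `u` above the rows of `M`, arranged so that `det (suc n) M`
-- unfolds to `laplace n (M zero) (M ∘ suc)`.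
laplace : ∀ n → (Fin (suc n) → ℤ) → Matrix n (suc n) → ℤ
laplace n u M = sumFin (suc n) λ j → sign (toℕ j) * (u j * det n (λ k l → M k (punchIn j l)))

det-cong : ∀ n {A B : Matrix n n} → (∀ i j → A i j ≡ B i j) → det n A ≡ det n B
det-cong zero    h = refl
det-cong (suc n) h = sum-cong (suc n) λ j → cong (sign (toℕ j) *_)
  (cong₂ _*_ (h zero j) (det-cong n λ k l → h (suc k) (punchIn j l)))

laplace-cong : ∀ n (u v : Fin (suc n) → ℤ) (A B : Matrix n (suc n)) → (∀ j → u j ≡ v j) →
  (∀ j → det n (λ k l → A k (punchIn j l)) ≡ det n (λ k l → B k (punchIn j l))) →
  laplace n u A ≡ laplace n v B
laplace-cong n u v A B h h′ = sum-cong (suc n) λ j → cong (sign (toℕ j) *_) (cong₂ _*_ (h j) (h′ j))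

laplace-linear : ∀ n c (u v : Fin (suc n) → ℤ) M →
  laplace n (λ j → u j + c * v j) M ≡ laplace n u M + c * laplace n v M
laplace-linear n c u v M = begin
  laplace n (λ j → u j + c * v j) M
    ≡⟨ sum-cong (suc n) (λ j → expand (sign (toℕ j)) (u j) c (v j) (det n (λ k l → M k (punchIn j l)))) ⟩
  sumFin (suc n) (λ j → term u j + c * term v j)
    ≡⟨ sum-+ (suc n) (term u) (λ j → c * term v j) ⟩
  laplace n u M + sumFin (suc n) (λ j → c * term v j)
    ≡⟨ cong (_+_ (laplace n u M)) (sum-* (suc n) c (term v)) ⟩
  laplace n u M + c * laplace n v M ∎
  where
  term : (Fin (suc n) → ℤ) → Fin (suc n) → ℤ
  term u j = sign (toℕ j) * (u j * det n (λ k l → M k (punchIn j l)))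
  expand : ∀ s a c b d → s * ((a + c * b) * d) ≡ s * (a * d) + c * (s * (b * d))
  expand = solve-∀

-- K j l is the weight of the ordered pair of distinct columns (j , punchIn j l); this
-- says that it does not depend on the order of the pair.
Symmetric : ∀ n → Matrix (suc n) n → Set
Symmetric zero    K = ⊤
Symmetric (suc n) K = (∀ l → K zero l ≡ K (suc l) zero) × Symmetric n (λ j l → K (suc j) (suc l))

-- The terms at `(zero , l)` and `(suc l , zero)` take the same two columns in opposite orders and
-- have opposite signs, so they cancel. In the remaining terms both signs flip at once, and
-- induction applies.
signed-sum-symmetric : ∀ n K → Symmetric n K →
  sumFin (suc n) (λ j → sumFin n (λ l → sign (toℕ j) * (sign (toℕ l) * K j l))) ≡ 0ℤ
signed-sum-symmetric zero    K _           = refl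
signed-sum-symmetric (suc n) K (K-zero , K-suc) = begin
  sumFin (suc n) (T zero) + sumFin (suc n) (λ j → T (suc j) zero + sumFin n (T (suc j) ∘ suc))
    ≡⟨ cong (_+_ (sumFin (suc n) (T zero))) (sum-+ (suc n) (λ j → T (suc j) zero) (λ j → sumFin n (T (suc j) ∘ suc))) ⟩
  sumFin (suc n) (T zero) + (sumFin (suc n) (λ j → T (suc j) zero) + rest)
    ≡⟨ cong₂ (λ x y → sumFin (suc n) (T zero) + (x + y))
         (trans (sum-cong (suc n) cancel) (sum-* (suc n) (- 1ℤ) (T zero))) rest≡0 ⟩
  sumFin (suc n) (T zero) + (- 1ℤ * sumFin (suc n) (T zero) + 0ℤ)
    ≡⟨ x-x (sumFin (suc n) (T zero)) ⟩
  0ℤ ∎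
  where
  T : Matrix (suc (suc n)) (suc n)
  T j l = sign (toℕ j) * (sign (toℕ l) * K j l)
  rest : ℤ
  rest = sumFin (suc n) (λ j → sumFin n (T (suc j) ∘ suc))
  x-x : ∀ x → x + (- 1ℤ * x + 0ℤ) ≡ 0ℤ
  x-x = solve-∀
  flip-sign : ∀ s x → (- s) * (1ℤ * x) ≡ - 1ℤ * (1ℤ * (s * x))
  flip-sign = solve-∀
  cancel : ∀ j → T (suc j) zero ≡ - 1ℤ * T zero j
  cancel j = begin
    sign (suc (toℕ j)) * (1ℤ * K (suc j) zero)
      ≡⟨ cong₂ (λ s x → s * (1ℤ * x)) (sign-suc (toℕ j)) (sym (K-zero j)) ⟩
    (- sign (toℕ j)) * (1ℤ * K zero j)
      ≡⟨ flip-sign (sign (toℕ j)) (K zero j) ⟩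
    - 1ℤ * T zero j ∎
  neg-neg : ∀ s t x → (- s) * ((- t) * x) ≡ s * (t * x)
  neg-neg = solve-∀
  rest≡0 : rest ≡ 0ℤ
  rest≡0 = trans
    (sum-cong (suc n) λ j → sum-cong n λ l → trans
      (cong₂ (λ s t → s * (t * K (suc j) (suc l))) (sign-suc (toℕ j)) (sign-suc (toℕ l)))
      (neg-neg (sign (toℕ j)) (sign (toℕ l)) _))
    (signed-sum-symmetric n _ K-suc)

symmetric-cong : ∀ n {K K′ : Matrix (suc n) n} → (∀ j l → K j l ≡ K′ j l) →
  Symmetric n K → Symmetric n K′
symmetric-cong zero    h _       = tt
symmetric-cong (suc n) h (a , b) =
  (λ l → trans (sym (h zero l)) (trans (a l) (h (suc l) zero))) ,
  symmetric-cong n (λ j l → h (suc j) (suc l)) b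

lift-suc : ∀ {k l} → (Fin k → Fin l) → Fin (suc k) → Fin (suc l)
lift-suc ψ zero    = zero
lift-suc ψ (suc c) = suc (ψ c)

-- The columns outside a pair, listed in increasing order, do not depend on the order of the pair.
-- `φ` sees only this list; the hypothesis on `φ` stands in for function extensionality.
column-pair-symmetric : ∀ n (u : Fin (suc (suc n)) → ℤ) (φ : (Fin n → Fin (suc (suc n))) → ℤ) →
  (∀ {ψ χ} → (∀ c → ψ c ≡ χ c) → φ ψ ≡ φ χ) →
  Symmetric (suc n) (λ j l → u j * (u (punchIn j l) * φ (λ c → punchIn j (punchIn l c))))
column-pair-symmetric zero    u φ ext =
  (λ l → trans (exchange (u zero) (u (suc l)) _) (cong (λ z → u (suc l) * (u zero * z)) (ext λ ()))) , tt
  where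
  exchange : ∀ a b c → a * (b * c) ≡ b * (a * c)
  exchange = solve-∀
column-pair-symmetric (suc n) u φ ext =
  (λ l → exchange (u zero) (u (suc l)) _) ,
  symmetric-cong (suc n)
    (λ j l → cong (λ z → u (suc j) * (u (suc (punchIn j l)) * z))
      (ext {lift-suc (λ c → punchIn j (punchIn l c))} {λ c → punchIn (suc j) (punchIn (suc l) c)}
        λ { zero → refl ; (suc c) → refl }))
    (column-pair-symmetric n (u ∘ suc) (φ ∘ lift-suc)
      (λ {ψ} {χ} h → ext {lift-suc ψ} {lift-suc χ} λ { zero → refl ; (suc c) → cong suc (h c) }))
  where
  exchange : ∀ a b c → a * (b * c) ≡ b * (a * c)
  exchange = solve-∀

-- Expanding along the two equal rows gives a signed sum over ordered pairs of columns with
-- symmetric weights.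
laplace-repeated-row : ∀ n (M : Matrix (suc n) (suc (suc n))) → laplace (suc n) (M zero) M ≡ 0ℤ
laplace-repeated-row n M = trans
  (sum-cong (suc (suc n)) λ j → begin
    sign (toℕ j) * (M zero j * sumFin (suc n) (inner j))
      ≡⟨ sym (*-assoc (sign (toℕ j)) (M zero j) _) ⟩
    sign (toℕ j) * M zero j * sumFin (suc n) (inner j)
      ≡⟨ sym (sum-* (suc n) (sign (toℕ j) * M zero j) (inner j)) ⟩
    sumFin (suc n) (λ l → sign (toℕ j) * M zero j * inner j l)
      ≡⟨ sum-cong (suc n) (λ l → regroup (sign (toℕ j)) (M zero j) (sign (toℕ l)) (M zero (punchIn j l)) (minor j l)) ⟩
    sumFin (suc n) (λ l → sign (toℕ j) * (sign (toℕ l) * (M zero j * (M zero (punchIn j l) * minor j l)))) ∎)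
  (signed-sum-symmetric (suc n) (λ j l → M zero j * (M zero (punchIn j l) * minor j l))
    (column-pair-symmetric n (M zero) (λ ψ → det n (λ k c → M (suc k) (ψ c)))
      (λ h → det-cong n λ k c → cong (M (suc k)) (h c))))
  where
  minor inner : Matrix (suc (suc n)) (suc n)
  minor j l = det n (λ k c → M (suc k) (punchIn j (punchIn l c)))
  inner j l = sign (toℕ l) * (M zero (punchIn j l) * minor j l)
  regroup : ∀ s a t b d → s * a * (t * (b * d)) ≡ s * (t * (a * (b * d)))
  regroup = solve-∀

-- Apart from the corner term, one side is expanded along the first column and then the first row,
-- the other in the opposite order; both give the same double sum over the deleted row `suc k` and
-- column `suc j`.
det-transpose : ∀ n (M : Matrix n n) → det n (λ i j → M j i) ≡ det n M
det-transpose zero          M = refl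
det-transpose (suc zero)    M = refl
det-transpose (suc (suc n)) M = cong₂ _+_
  (cong (λ z → 1ℤ * (M zero zero * z)) (det-transpose (suc n) (λ i j → M (suc i) (suc j))))
  (begin
    sumFin (suc n) (λ k → sign (suc (toℕ k)) * (M (suc k) zero *
        det (suc n) (λ i j → M (punchIn (suc k) j) (suc i))))
      ≡⟨ sum-cong (suc n) (λ k → trans
           (cong (λ z → sign (suc (toℕ k)) * (M (suc k) zero * z))
             (det-transpose (suc n) (λ j i → M (punchIn (suc k) j) (suc i))))
           (inward (sign (suc (toℕ k))) (M (suc k) zero) (col k))) ⟩
    sumFin (suc n) (λ k → sumFin (suc n) (λ j → sign (suc (toℕ k)) * (M (suc k) zero * col k j)))
      ≡⟨ sum-swap (suc n) (suc n) (λ k j → sign (suc (toℕ k)) * (M (suc k) zero * col k j)) ⟩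
    sumFin (suc n) (λ j → sumFin (suc n) (λ k → sign (suc (toℕ k)) * (M (suc k) zero * col k j)))
      ≡⟨ sum-cong (suc n) (λ j → sum-cong (suc n) λ k → exchange j k) ⟩
    sumFin (suc n) (λ j → sumFin (suc n) (λ k → sign (suc (toℕ j)) * (M zero (suc j) * row j k)))
      ≡⟨ sum-cong (suc n) (λ j → trans
           (sym (inward (sign (suc (toℕ j))) (M zero (suc j)) (row j)))
           (cong (λ z → sign (suc (toℕ j)) * (M zero (suc j) * z))
             (det-transpose (suc n) (λ i l → M (suc i) (punchIn (suc j) l))))) ⟩
    sumFin (suc n) (λ j → sign (suc (toℕ j)) * (M zero (suc j) *
        det (suc n) (λ i l → M (suc i) (punchIn (suc j) l)))) ∎)
  where
  inner : Matrix (suc n) (suc n)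
  inner k j = det n (λ i l → M (suc (punchIn k i)) (suc (punchIn j l)))
  col row : Matrix (suc n) (suc n)
  col k j = sign (toℕ j) * (M zero (suc j) * inner k j)
  row j k = sign (toℕ k) * (M (suc k) zero * det n (λ l i → M (suc (punchIn k i)) (suc (punchIn j l))))
  inward : ∀ s a f → s * (a * sumFin (suc n) f) ≡ sumFin (suc n) (λ j → s * (a * f j))
  inward s a f = sym (trans (sum-cong (suc n) λ j → sym (*-assoc s a (f j)))
    (trans (sum-* (suc n) (s * a) f) (*-assoc s a _)))
  regroup : ∀ s a t b d → (- s) * (a * (t * (b * d))) ≡ (- t) * (b * (s * (a * d)))
  regroup = solve-∀
  exchange : ∀ j k → sign (suc (toℕ k)) * (M (suc k) zero * col k j) ≡
                     sign (suc (toℕ j)) * (M zero (suc j) * row j k)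
  exchange j k = begin
    sign (suc (toℕ k)) * (M (suc k) zero * (sign (toℕ j) * (M zero (suc j) * inner k j)))
      ≡⟨ cong (_* (M (suc k) zero * (sign (toℕ j) * (M zero (suc j) * inner k j)))) (sign-suc (toℕ k)) ⟩
    (- sign (toℕ k)) * (M (suc k) zero * (sign (toℕ j) * (M zero (suc j) * inner k j)))
      ≡⟨ regroup (sign (toℕ k)) (M (suc k) zero) (sign (toℕ j)) (M zero (suc j)) (inner k j) ⟩
    (- sign (toℕ j)) * (M zero (suc j) * (sign (toℕ k) * (M (suc k) zero * inner k j)))
      ≡⟨ cong₂ (λ s d → s * (M zero (suc j) * (sign (toℕ k) * (M (suc k) zero * d))))
           (sym (sign-suc (toℕ j)))
           (sym (det-transpose n (λ i l → M (suc (punchIn k i)) (suc (punchIn j l))))) ⟩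
    sign (suc (toℕ j)) * (M zero (suc j) * row j k) ∎

-- The added rows are rows of `B`: the top row is cleared first, against a row of `B`, and the rows
-- below are changed by induction afterwards.
det-rows-below : ∀ n (c : Fin n → ℤ) (A B : Matrix (suc n) (suc n)) →
  (∀ i j → B (inject₁ i) j ≡ A (inject₁ i) j + c i * B (suc i) j) →
  (∀ j → B (fromℕ n) j ≡ A (fromℕ n) j) →
  det (suc n) B ≡ det (suc n) A
det-rows-below zero    c A B step last = det-cong 1 {B} {A} λ { zero zero → last zero }
det-rows-below (suc n) c A B step last = begin
  laplace (suc n) (B zero) (B ∘ suc)
    ≡⟨ laplace-cong (suc n) (B zero) (λ j → A zero j + c zero * B (suc zero) j) (B ∘ suc) (B ∘ suc) (step zero) (λ _ → refl) ⟩
  laplace (suc n) (λ j → A zero j + c zero * B (suc zero) j) (B ∘ suc)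
    ≡⟨ laplace-linear (suc n) (c zero) (A zero) (B (suc zero)) (B ∘ suc) ⟩
  laplace (suc n) (A zero) (B ∘ suc) + c zero * laplace (suc n) (B (suc zero)) (B ∘ suc)
    ≡⟨ cong₂ (λ x y → x + c zero * y)
         (laplace-cong (suc n) (A zero) (A zero) (B ∘ suc) (A ∘ suc) (λ _ → refl) λ j →
           det-rows-below n (c ∘ suc) (λ k l → A (suc k) (punchIn j l)) (λ k l → B (suc k) (punchIn j l)) (λ i l → step (suc i) (punchIn j l)) (λ l → last (punchIn j l)))
         (laplace-repeated-row n (B ∘ suc)) ⟩
  det (suc (suc n)) A + c zero * 0ℤ
    ≡⟨ cong (_+_ (det (suc (suc n)) A)) (*-zeroʳ (c zero)) ⟩
  det (suc (suc n)) A + 0ℤ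
    ≡⟨ +-identityʳ _ ⟩
  det (suc (suc n)) A ∎

-- Here the added rows are rows of `A`. Splitting the second row of `B` leaves a determinant whose
-- first two rows are both `A zero`; the other part is covered by induction.
det-rows-above : ∀ n (c : Fin n → ℤ) (A B : Matrix (suc n) (suc n)) →
  (∀ i j → B (suc i) j ≡ A (suc i) j + c i * A (inject₁ i) j) →
  (∀ j → B zero j ≡ A zero j) →
  det (suc n) B ≡ det (suc n) A
det-rows-above zero    c A B step first = det-cong 1 {B} {A} λ { zero zero → first zero }
det-rows-above (suc n) c A B step first = begin
  laplace (suc n) (B zero) (B ∘ suc)
    ≡⟨ sum-cong (suc (suc n)) (λ j → trans
         (cong₂ (λ x y → sign (toℕ j) * (x * y)) (first j) (minor j))
         (expand (sign (toℕ j)) (A zero j) (minor-of A j) (c zero) (det (suc n) (λ k l → A₀B k (punchIn j l))))) ⟩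
  sumFin (suc (suc n)) (λ j → P j + c zero * Q j)
    ≡⟨ sum-+ (suc (suc n)) P (λ j → c zero * Q j) ⟩
  det (suc (suc n)) A + sumFin (suc (suc n)) (λ j → c zero * Q j)
    ≡⟨ cong (_+_ (det (suc (suc n)) A)) (sum-* (suc (suc n)) (c zero) Q) ⟩
  det (suc (suc n)) A + c zero * laplace (suc n) (A zero) A₀B
    ≡⟨ cong (λ z → det (suc (suc n)) A + c zero * z) (laplace-repeated-row n A₀B) ⟩
  det (suc (suc n)) A + c zero * 0ℤ
    ≡⟨ cong (_+_ (det (suc (suc n)) A)) (*-zeroʳ (c zero)) ⟩
  det (suc (suc n)) A + 0ℤ
    ≡⟨ +-identityʳ _ ⟩
  det (suc (suc n)) A ∎
  where
  with-top : (Fin (suc (suc n)) → ℤ) → Matrix (suc n) (suc (suc n))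
  with-top u zero    = u
  with-top u (suc i) = B (suc (suc i))
  A₀B : Matrix (suc n) (suc (suc n))
  A₀B = with-top (A zero)
  minor-of : Matrix (suc (suc n)) (suc (suc n)) → Fin (suc (suc n)) → ℤ
  minor-of M j = det (suc n) (λ k l → M (suc k) (punchIn j l))
  P Q : Fin (suc (suc n)) → ℤ
  P j = sign (toℕ j) * (A zero j * det (suc n) (λ k l → A (suc k) (punchIn j l)))
  Q j = sign (toℕ j) * (A zero j * det (suc n) (λ k l → A₀B k (punchIn j l)))
  expand : ∀ s a x c y → s * (a * (x + c * y)) ≡ s * (a * x) + c * (s * (a * y))
  expand = solve-∀
  minor : ∀ j → det (suc n) (λ k l → B (suc k) (punchIn j l)) ≡
    det (suc n) (λ k l → A (suc k) (punchIn j l)) + c zero * det (suc n) (λ k l → A₀B k (punchIn j l))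
  minor j = begin
    det (suc n) (λ k l → B (suc k) (punchIn j l))
      ≡⟨ laplace-cong n (λ l → B (suc zero) (punchIn j l)) (λ l → A (suc zero) (punchIn j l) + c zero * A zero (punchIn j l)) (λ k l → B (suc (suc k)) (punchIn j l)) (λ k l → B (suc (suc k)) (punchIn j l)) (λ l → step zero (punchIn j l)) (λ _ → refl) ⟩
    laplace n (λ l → A (suc zero) (punchIn j l) + c zero * A zero (punchIn j l))
              (λ k l → B (suc (suc k)) (punchIn j l))
      ≡⟨ laplace-linear n (c zero) (λ l → A (suc zero) (punchIn j l)) (λ l → A zero (punchIn j l)) (λ k l → B (suc (suc k)) (punchIn j l)) ⟩
    det (suc n) (λ k l → with-top (A (suc zero)) k (punchIn j l)) + c zero * det (suc n) (λ k l → A₀B k (punchIn j l))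
      ≡⟨ cong (_+ c zero * det (suc n) (λ k l → A₀B k (punchIn j l)))
           (det-rows-above n (c ∘ suc) (λ k l → A (suc k) (punchIn j l)) (λ k l → with-top (A (suc zero)) k (punchIn j l)) (λ i l → step (suc i) (punchIn j l)) (λ _ → refl)) ⟩
    det (suc n) (λ k l → A (suc k) (punchIn j l)) + c zero * det (suc n) (λ k l → A₀B k (punchIn j l)) ∎

-- Divided differences and the Sylvester matrix

-- dd L c ε b is the divided difference f[ε 0, …, ε b] of f = c 0 + c 1 x + … + c (L-1) x^(L-1),
-- i.e. the coefficient of (x - ε 0)⋯(x - ε (b-1)) in the Newton expansion of f; it is computed
-- by Horner's scheme.
dd : ℕ → (ℕ → ℤ) → (ℕ → ℤ) → ℕ → ℤ
dd zero    c ε b       = 0ℤ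
dd (suc L) c ε zero    = c 0 + ε 0 * dd L (c ∘ suc) ε 0
dd (suc L) c ε (suc b) = dd L (c ∘ suc) ε b + ε (suc b) * dd L (c ∘ suc) ε (suc b)

-- The recurrence that defines divided differences, without the division; it is a polynomial
-- identity at each Horner step and so also holds for repeated nodes.
dd-shift : ∀ L c ε b → dd L c (ε ∘ suc) b ≡ dd L c ε b + (ε (suc b) - ε 0) * dd L c ε (suc b)
dd-shift zero    c ε b       = sym (trans (+-identityˡ ((ε (suc b) - ε 0) * 0ℤ)) (*-zeroʳ (ε (suc b) - ε 0)))
dd-shift (suc L) c ε zero    = trans
  (cong (λ z → c 0 + ε 1 * z) (dd-shift L (c ∘ suc) ε 0))
  (identity (c 0) (ε 0) (ε 1) (dd L (c ∘ suc) ε 0) (dd L (c ∘ suc) ε 1))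
  where
  identity : ∀ c x y d₀ d₁ → c + y * (d₀ + (y - x) * d₁) ≡ (c + x * d₀) + (y - x) * (d₀ + y * d₁)
  identity = solve-∀
dd-shift (suc L) c ε (suc b) = trans
  (cong₂ (λ u v → u + ε (suc (suc b)) * v) (dd-shift L (c ∘ suc) ε b) (dd-shift L (c ∘ suc) ε (suc b)))
  (identity (ε 0) (ε (suc b)) (ε (suc (suc b)))
    (dd L (c ∘ suc) ε b) (dd L (c ∘ suc) ε (suc b)) (dd L (c ∘ suc) ε (suc (suc b))))
  where
  identity : ∀ x y z d₀ d₁ d₂ → (d₀ + (y - x) * d₁) + z * (d₁ + (z - x) * d₂) ≡
                                (d₀ + y * d₁) + (z - x) * (d₁ + z * d₂)
  identity = solve-∀

dd-vanish : ∀ L c ε b → L ≤ b → dd L c ε b ≡ 0ℤ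
dd-vanish zero    c ε b       _         = refl
dd-vanish (suc L) c ε (suc b) (s≤s L≤b) = begin
  dd L (c ∘ suc) ε b + ε (suc b) * dd L (c ∘ suc) ε (suc b)
    ≡⟨ cong₂ (λ u v → u + ε (suc b) * v) (dd-vanish L (c ∘ suc) ε b L≤b)
         (dd-vanish L (c ∘ suc) ε (suc b) (ℕ.m≤n⇒m≤1+n L≤b)) ⟩
  0ℤ + ε (suc b) * 0ℤ
    ≡⟨ trans (+-identityˡ (ε (suc b) * 0ℤ)) (*-zeroʳ (ε (suc b))) ⟩
  0ℤ ∎

dd-leading : ∀ m c ε → dd (suc m) c ε m ≡ c m
dd-leading zero    c ε = trans (cong (_+_ (c 0)) (*-zeroʳ (ε 0))) (+-identityʳ (c 0))
dd-leading (suc m) c ε = begin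
  dd (suc m) (c ∘ suc) ε m + ε (suc m) * dd (suc m) (c ∘ suc) ε (suc m)
    ≡⟨ cong₂ (λ u v → u + ε (suc m) * v) (dd-leading m (c ∘ suc) ε)
         (dd-vanish (suc m) (c ∘ suc) ε (suc m) ℕ.≤-refl) ⟩
  c (suc m) + ε (suc m) * 0ℤ
    ≡⟨ trans (cong (_+_ (c (suc m))) (*-zeroʳ (ε (suc m)))) (+-identityʳ (c (suc m))) ⟩
  c (suc m) ∎

-- At zero nodes the Newton polynomials are the powers of x.
dd-zero-nodes : ∀ L c b → b < L → dd L c (λ _ → 0ℤ) b ≡ c b
dd-zero-nodes (suc L) c zero    _         = +-identityʳ (c 0)
dd-zero-nodes (suc L) c (suc b) (s≤s b<L) =
  trans (+-identityʳ (dd L (c ∘ suc) (λ _ → 0ℤ) b)) (dd-zero-nodes L (c ∘ suc) b b<L)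

dd-cong : ∀ L c {ε η : ℕ → ℤ} b → (∀ t → t ≤ b → ε t ≡ η t) → dd L c ε b ≡ dd L c η b
dd-cong zero    c b       h = refl
dd-cong (suc L) c zero    h = cong₂ (λ u v → c 0 + u * v) (h 0 z≤n) (dd-cong L (c ∘ suc) 0 h)
dd-cong (suc L) c (suc b) h = cong₂ _+_ (dd-cong L (c ∘ suc) b λ t t≤b → h t (ℕ.m≤n⇒m≤1+n t≤b))
  (cong₂ _*_ (h (suc b) ℕ.≤-refl) (dd-cong L (c ∘ suc) (suc b) h))

dd-value : ∀ L c ε → dd L c ε 0 ≡ sumFin L (λ k → c (toℕ k) * ε 0 ^ toℕ k)
dd-value zero    c ε = refl
dd-value (suc L) c ε = cong₂ _+_ (sym (*-identityʳ (c 0))) (begin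
  ε 0 * dd L (c ∘ suc) ε 0
    ≡⟨ cong (ε 0 *_) (dd-value L (c ∘ suc) ε) ⟩
  ε 0 * sumFin L (λ k → c (suc (toℕ k)) * ε 0 ^ toℕ k)
    ≡⟨ sum-* L (ε 0) (λ k → c (suc (toℕ k)) * ε 0 ^ toℕ k) ⟨
  sumFin L (λ k → ε 0 * (c (suc (toℕ k)) * ε 0 ^ toℕ k))
    ≡⟨ sum-cong L (λ k → exchange (ε 0) (c (suc (toℕ k))) (ε 0 ^ toℕ k)) ⟩
  sumFin L (λ k → c (suc (toℕ k)) * (ε 0 * ε 0 ^ toℕ k)) ∎)
  where
  exchange : ∀ x a y → x * (a * y) ≡ a * (x * y)
  exchange = solve-∀

-- The coefficient of (x - ε 0)⋯(x - ε (b-1)) in (x - ε 0)⋯(x - ε (a-1)) f.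
entry : ℕ → (ℕ → ℤ) → (ℕ → ℤ) → ℕ → ℕ → ℤ
entry L c ε zero    b       = dd L c ε b
entry L c ε (suc a) zero    = 0ℤ
entry L c ε (suc a) (suc b) = entry L c (ε ∘ suc) a b

-- This is `dd-shift` for the nodes from `ε a` to `ε (suc b)`. For `suc b = a` the last entry on the
-- right need not be zero, but its factor is `ε a - ε a`.
entry-shift : ∀ L c ε a b →
  entry L c (ε ∘ suc) a b ≡ entry L c ε a b + (ε (suc b) - ε a) * entry L c ε a (suc b)
entry-shift L c ε zero          b       = dd-shift L c ε b
entry-shift L c ε (suc zero)    zero    = vanish (ε 1) (dd L c (ε ∘ suc) 0)
  where
  vanish : ∀ x y → 0ℤ ≡ 0ℤ + (x - x) * y
  vanish = solve-∀
entry-shift L c ε (suc (suc a)) zero    = sym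
  (trans (+-identityˡ ((ε 1 - ε (suc (suc a))) * 0ℤ)) (*-zeroʳ (ε 1 - ε (suc (suc a)))))
entry-shift L c ε (suc a)       (suc b) = entry-shift L c (ε ∘ suc) a b

entry-vanish : ∀ L c ε a b → L ℕ.+ a ≤ b → entry L c ε a b ≡ 0ℤ
entry-vanish L c ε zero    b       h = dd-vanish L c ε b (subst (_≤ b) (ℕ.+-identityʳ L) h)
entry-vanish L c ε (suc a) zero    h = refl
entry-vanish L c ε (suc a) (suc b) h = entry-vanish L c (ε ∘ suc) a b
  (ℕ.≤-pred (subst (_≤ suc b) (ℕ.+-suc L a) h))

entry-below : ∀ L c ε a b → b < a → entry L c ε a b ≡ 0ℤ
entry-below L c ε (suc a) zero    _         = refl
entry-below L c ε (suc a) (suc b) (s≤s b<a) = entry-below L c (ε ∘ suc) a b b<a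

entry-cong : ∀ L c {ε η : ℕ → ℤ} a b → (∀ t → t ≤ b → ε t ≡ η t) → entry L c ε a b ≡ entry L c η a b
entry-cong L c zero    b       h = dd-cong L c b h
entry-cong L c (suc a) zero    h = refl
entry-cong L c (suc a) (suc b) h = entry-cong L c a b λ t t≤b → h (suc t) (s≤s t≤b)

entry-window : ∀ L c ε a d → entry L c ε a (a ℕ.+ d) ≡ dd L c (λ t → ε (a ℕ.+ t)) d
entry-window L c ε zero    d = refl
entry-window L c ε (suc a) d = entry-window L c (ε ∘ suc) a d

entry-zero-nodes : ∀ L c a d → d < L → entry L c (λ _ → 0ℤ) a (a ℕ.+ d) ≡ c d
entry-zero-nodes L c a d d<L = trans (entry-window L c (λ _ → 0ℤ) a d) (dd-zero-nodes L c d d<L)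

choose : {A : Set} → ℕ → ℕ → A → A → A
choose zero    i       x y = y
choose (suc n) zero    x y = x
choose (suc n) (suc i) x y = choose n i x y

choose-< : ∀ {A : Set} {n i} {x y : A} → i < n → choose n i x y ≡ x
choose-< {n = suc n} {zero}  _         = refl
choose-< {n = suc n} {suc i} (s≤s i<n) = choose-< i<n

choose-≥ : ∀ {A : Set} {n i} {x y : A} → n ≤ i → choose n i x y ≡ y
choose-≥ {n = zero}              _         = refl
choose-≥ {n = suc n} {suc i} (s≤s n≤i) = choose-≥ n≤i

-- Sylvester rows and columns run from high powers to low ones; this converts between position and
-- exponent.
opp : ℕ → ℕ → ℕ
opp N i = N ∸ suc i

opp-suc : ∀ {N i} → suc i < N → opp N i ≡ suc (opp N (suc i))
opp-suc {suc N} {i} (s≤s i<N) = ℕ.+-∸-assoc 1 i<N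

opp-< : ∀ {N i} → i < N → opp N i < N
opp-< {suc N} {i} _ = s≤s (ℕ.m∸n≤m N i)

opp-≥ : ∀ {N i} → N ≤ suc i → opp N i ≡ 0
opp-≥ = ℕ.m≤n⇒m∸n≡0

module Newton (m n : ℕ) (f g : ℕ → ℤ) where

  -- The exponent of the multiplier in row `i`: it falls from n-1 to 0 over the rows of f and, for N
  -- = m + n, from m-1 to 0 over the rows of g.
  rowIndex : ℕ → ℕ → ℕ
  rowIndex N i = choose n i (opp n i) (opp N i)

  rowEntry : (ℕ → ℤ) → ℕ → ℕ → ℕ → ℤ
  rowEntry ε i a b = choose n i (entry (suc m) f ε a b) (entry (suc n) g ε a b)

  -- The rows of the Sylvester matrix are the polynomials x^a f (a < n) and x^a g (a < m), highest
  -- power first; here x^a is replaced by (x - ε 0)⋯(x - ε (a-1)), in the rows and in the columns.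
  newton : ∀ N → (ℕ → ℤ) → Matrix N N
  newton N ε i j = rowEntry ε (toℕ i) (rowIndex N (toℕ i)) (opp N (toℕ j))

  rowEntry-shift : ∀ ε i a b →
    rowEntry (ε ∘ suc) i a b ≡ rowEntry ε i a b + (ε (suc b) - ε a) * rowEntry ε i a (suc b)
  rowEntry-shift ε i a b with i <? n
  ... | yes i<n = trans (choose-< i<n) (trans (entry-shift (suc m) f ε a b)
        (sym (cong₂ (λ u v → u + (ε (suc b) - ε a) * v) (choose-< i<n) (choose-< i<n))))
  ... | no  i≮n = trans (choose-≥ i≥n) (trans (entry-shift (suc n) g ε a b)
        (sym (cong₂ (λ u v → u + (ε (suc b) - ε a) * v) (choose-≥ i≥n) (choose-≥ i≥n))))
    where
    i≥n : n ≤ i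
    i≥n = ℕ.≮⇒≥ i≮n

  -- All row polynomials have degree below m + n. This zero column serves as the missing neighbour
  -- of the first column in `column-first`.
  rowEntry-vanish : ∀ {N} → N ≡ m ℕ.+ n → ∀ ε i → i < N → rowEntry ε i (rowIndex N i) N ≡ 0ℤ
  rowEntry-vanish {N} N≡ ε i i<N with i <? n
  ... | yes i<n = trans (choose-< i<n) (trans
        (cong (λ a → entry (suc m) f ε a N) (choose-< i<n))
        (entry-vanish (suc m) f ε (opp n i) N
          (subst₂ _≤_ (ℕ.+-suc m (opp n i)) (sym N≡) (ℕ.+-monoʳ-≤ m (opp-< i<n)))))
  ... | no  i≮n = trans (choose-≥ i≥n) (trans
        (cong (λ a → entry (suc n) g ε a N) (choose-≥ i≥n))
        (entry-vanish (suc n) g ε (opp N i) N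
          (subst (suc n ℕ.+ opp N i ≤_) (ℕ.m+[n∸m]≡n i<N) (ℕ.+-monoˡ-≤ (opp N i) (s≤s i≥n)))))
    where
    i≥n : n ≤ i
    i≥n = ℕ.≮⇒≥ i≮n

  -- A row of exponent a is changed by `ε 0 - ε a` times the next row. Where the next row belongs to
  -- the other polynomial, a = 0 and this factor vanishes.
  rowIndex-next : ∀ {N} i → suc i < N → rowIndex N i ≡ 0 ⊎
    (rowIndex N i ≡ suc (rowIndex N (suc i)) × (∀ {x y : ℤ} → choose n i x y ≡ choose n (suc i) x y))
  rowIndex-next {N} i 1+i<N with i <? n | suc i <? n
  ... | _       | yes 1+i<n = inj₂
        (trans (choose-< i<n) (trans (opp-suc 1+i<n) (cong suc (sym (choose-< 1+i<n)))) ,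
         trans (choose-< i<n) (sym (choose-< 1+i<n)))
    where
    i<n : i < n
    i<n = ℕ.<-trans (ℕ.n<1+n i) 1+i<n
  ... | yes i<n | no  1+i≮n = inj₁ (trans (choose-< i<n) (opp-≥ (ℕ.≮⇒≥ 1+i≮n)))
  ... | no  i≮n | no  1+i≮n = inj₂
        (trans (choose-≥ (ℕ.≮⇒≥ i≮n)) (trans (opp-suc 1+i<N) (cong suc (sym (choose-≥ (ℕ.≮⇒≥ 1+i≮n))))) ,
         trans (choose-≥ (ℕ.≮⇒≥ i≮n)) (sym (choose-≥ (ℕ.≮⇒≥ 1+i≮n))))

  rowIndex-last : ∀ {N} → suc N ≡ m ℕ.+ n → rowIndex (suc N) N ≡ 0
  rowIndex-last {N} N≡ with N <? n
  ... | yes N<n = trans (choose-< N<n) (opp-≥ (subst (n ≤_) (sym N≡) (ℕ.m≤n+m n m)))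
  ... | no  N≮n = trans (choose-≥ (ℕ.≮⇒≥ N≮n)) (opp-≥ (ℕ.≤-refl {suc N}))

  -- Columns first: (x - ε 0)⋯(x - ε b) is (x - ε 1)⋯(x - ε (b+1)) plus ε (b+1) - ε 0 times (x - ε
  -- 1)⋯(x - ε b), so each column gains a multiple of the old column before it. Then rows: (x - ε
  -- 1)⋯(x - ε a) is (x - ε 0)⋯(x - ε (a-1)) plus ε 0 - ε a times (x - ε 1)⋯(x - ε (a-1)), which
  -- belongs to the new row below.
  det-newton-shift : ∀ N → N ≡ m ℕ.+ n → ∀ ε → det N (newton N (ε ∘ suc)) ≡ det N (newton N ε)
  det-newton-shift zero    N≡ ε = refl
  det-newton-shift (suc N) N≡ ε = begin
    det (suc N) (newton (suc N) (ε ∘ suc))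
      ≡⟨ det-rows-below N (λ i → ε 0 - ε (rowIndex (suc N) (toℕ (inject₁ i)))) mixed
           (newton (suc N) (ε ∘ suc)) row-step row-last ⟩
    det (suc N) mixed
      ≡⟨ det-transpose (suc N) mixed ⟨
    det (suc N) (λ j i → mixed i j)
      ≡⟨ det-rows-above N (λ j → ε (suc (opp (suc N) (suc (toℕ j)))) - ε 0)
           (λ j i → newton (suc N) ε i j) (λ j i → mixed i j) column-step column-first ⟩
    det (suc N) (λ j i → newton (suc N) ε i j)
      ≡⟨ det-transpose (suc N) (newton (suc N) ε) ⟩
    det (suc N) (newton (suc N) ε) ∎
    where
    R : Fin (suc N) → ℕ → ℤ
    R i b = rowEntry ε (toℕ i) (rowIndex (suc N) (toℕ i)) b
    -- Nodes ε for the rows and ε ∘ suc for the columns.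
    mixed : Matrix (suc N) (suc N)
    mixed i j = newton (suc N) ε i j + (ε (suc (opp (suc N) (toℕ j))) - ε 0) * R i (suc (opp (suc N) (toℕ j)))

    column-step : ∀ j i → mixed i (suc j) ≡ newton (suc N) ε i (suc j) +
      (ε (suc (opp (suc N) (suc (toℕ j)))) - ε 0) * newton (suc N) ε i (inject₁ j)
    column-step j i = cong
      (λ b → newton (suc N) ε i (suc j) + (ε (suc (opp (suc N) (suc (toℕ j)))) - ε 0) * R i b)
      (sym (trans (cong (opp (suc N)) (toℕ-inject₁ j)) (opp-suc (s≤s (toℕ<n j)))))

    column-first : ∀ i → mixed i zero ≡ newton (suc N) ε i zero
    column-first i = begin
      newton (suc N) ε i zero + (ε (suc N) - ε 0) * R i (suc N)
        ≡⟨ cong (λ z → newton (suc N) ε i zero + (ε (suc N) - ε 0) * z)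
             (rowEntry-vanish N≡ ε (toℕ i) (toℕ<n i)) ⟩
      newton (suc N) ε i zero + (ε (suc N) - ε 0) * 0ℤ
        ≡⟨ trans (cong (_+_ (newton (suc N) ε i zero)) (*-zeroʳ (ε (suc N) - ε 0)))
             (+-identityʳ (newton (suc N) ε i zero)) ⟩
      newton (suc N) ε i zero ∎

    split : ∀ r x y z t → r + (z - x) * t ≡ (r + (z - y) * t) + (y - x) * t
    split = solve-∀

    row-shift : ∀ i j → newton (suc N) (ε ∘ suc) i j ≡
      mixed i j + (ε 0 - ε (rowIndex (suc N) (toℕ i))) * R i (suc (opp (suc N) (toℕ j)))
    row-shift i j = trans
      (rowEntry-shift ε (toℕ i) (rowIndex (suc N) (toℕ i)) (opp (suc N) (toℕ j)))
      (split (newton (suc N) ε i j) (ε (rowIndex (suc N) (toℕ i))) (ε 0)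
        (ε (suc (opp (suc N) (toℕ j)))) (R i (suc (opp (suc N) (toℕ j)))))

    same-at-0 : ∀ {a} u v → a ≡ 0 → (ε 0 - ε a) * u ≡ (ε 0 - ε a) * v
    same-at-0 u v refl = vanish (ε 0) u v
      where
      vanish : ∀ x u v → (x - x) * u ≡ (x - x) * v
      vanish = solve-∀

    next-row : ∀ (i : Fin N) j →
      (ε 0 - ε (rowIndex (suc N) (toℕ (inject₁ i)))) * R (inject₁ i) (suc (opp (suc N) (toℕ j))) ≡
      (ε 0 - ε (rowIndex (suc N) (toℕ (inject₁ i)))) * newton (suc N) (ε ∘ suc) (suc i) j
    next-row i j rewrite toℕ-inject₁ i with rowIndex-next {suc N} (toℕ i) (s≤s (toℕ<n i))
    ... | inj₁ a≡0 = same-at-0 (rowEntry ε (toℕ i) (rowIndex (suc N) (toℕ i)) (suc (opp (suc N) (toℕ j))))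
                       (newton (suc N) (ε ∘ suc) (suc i) j) a≡0
    -- `entry` at `ε`, `suc a`, `suc b` unfolds to `entry` at `ε ∘ suc`, `a`, `b`: the next row at
    -- the shifted nodes.
    ... | inj₂ (a≡ , same-block) = cong ((ε 0 - ε (rowIndex (suc N) (toℕ i))) *_) (trans
          (cong (λ a → rowEntry ε (toℕ i) a (suc (opp (suc N) (toℕ j)))) a≡) same-block)

    row-step : ∀ i j → newton (suc N) (ε ∘ suc) (inject₁ i) j ≡ mixed (inject₁ i) j +
      (ε 0 - ε (rowIndex (suc N) (toℕ (inject₁ i)))) * newton (suc N) (ε ∘ suc) (suc i) j
    row-step i j = trans (row-shift (inject₁ i) j) (cong (_+_ (mixed (inject₁ i) j)) (next-row i j))

    row-last : ∀ j → newton (suc N) (ε ∘ suc) (fromℕ N) j ≡ mixed (fromℕ N) j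
    row-last j = begin
      newton (suc N) (ε ∘ suc) (fromℕ N) j
        ≡⟨ row-shift (fromℕ N) j ⟩
      mixed (fromℕ N) j + (ε 0 - ε (rowIndex (suc N) (toℕ (fromℕ N)))) * Rₙ
        ≡⟨ cong (_+_ (mixed (fromℕ N) j)) (same-at-0 Rₙ 0ℤ
             (trans (cong (rowIndex (suc N)) (toℕ-fromℕ N)) (rowIndex-last N≡))) ⟩
      mixed (fromℕ N) j + (ε 0 - ε (rowIndex (suc N) (toℕ (fromℕ N)))) * 0ℤ
        ≡⟨ trans (cong (_+_ (mixed (fromℕ N) j)) (*-zeroʳ (ε 0 - ε (rowIndex (suc N) (toℕ (fromℕ N))))))
             (+-identityʳ (mixed (fromℕ N) j)) ⟩
      mixed (fromℕ N) j ∎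
      where
      Rₙ : ℤ
      Rₙ = R (fromℕ N) (suc (opp (suc N) (toℕ j)))

  truncate : ℕ → (ℕ → ℤ) → ℕ → ℤ
  truncate zero    ε t       = 0ℤ
  truncate (suc k) ε zero    = ε 0
  truncate (suc k) ε (suc t) = truncate k (ε ∘ suc) t

  truncate-agree : ∀ k ε t → t < k → truncate k ε t ≡ ε t
  truncate-agree (suc k) ε zero    _         = refl
  truncate-agree (suc k) ε (suc t) (s≤s t<k) = truncate-agree k (ε ∘ suc) t t<k

  -- Each shift drops one node; after `k` shifts only zero nodes remain.
  det-truncate : ∀ N → N ≡ m ℕ.+ n → ∀ k ε → det N (newton N (truncate k ε)) ≡ det N (newton N (λ _ → 0ℤ))
  det-truncate N N≡ zero    ε = refl
  det-truncate N N≡ (suc k) ε = trans (sym (det-newton-shift N N≡ (truncate (suc k) ε)))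
    (det-truncate N N≡ k (ε ∘ suc))

  newton-cong : ∀ N {ε η : ℕ → ℤ} → (∀ t → t < N → ε t ≡ η t) → ∀ i j → newton N ε i j ≡ newton N η i j
  newton-cong N h i j = cong₂ (choose n (toℕ i))
    (entry-cong (suc m) f (rowIndex N (toℕ i)) (opp N (toℕ j)) below)
    (entry-cong (suc n) g (rowIndex N (toℕ i)) (opp N (toℕ j)) below)
    where
    below : ∀ t → t ≤ opp N (toℕ j) → _ ≡ _
    below t t≤ = h t (ℕ.≤-<-trans t≤ (opp-< (toℕ<n j)))

  det-newton : ∀ N → N ≡ m ℕ.+ n → ∀ ε → det N (newton N ε) ≡ det N (newton N (λ _ → 0ℤ))
  det-newton N N≡ ε = trans
    (det-cong N (newton-cong N λ t t<N → sym (truncate-agree N ε t t<N)))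
    (det-truncate N N≡ N ε)

-- The Sylvester matrix as the Newton matrix with zero nodes

coeff-monic : ∀ m a → coeff m a m ≡ 1ℤ
coeff-monic m a with m <? m
... | yes m<m = contradiction m<m (ℕ.<-irrefl refl)
... | no  _   with m ℕ.≟ m
...   | yes _   = refl
...   | no  m≢m = contradiction refl m≢m

-- Both sides are N - 1.
opp-opp : ∀ d q {t j N} → N ≡ d ℕ.+ q → t < q → j < N → opp N j ℕ.+ j ≡ d ℕ.+ opp q t ℕ.+ t
opp-opp d q {t} {j} {N} N≡ t<q j<N = ℕ.suc-injective (begin
  suc (opp N j ℕ.+ j)             ≡⟨ ℕ.+-suc (opp N j) j ⟨
  opp N j ℕ.+ suc j               ≡⟨ ℕ.m∸n+n≡m j<N ⟩
  N                               ≡⟨ N≡ ⟩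
  d ℕ.+ q                         ≡⟨ cong (d ℕ.+_) (ℕ.m∸n+n≡m t<q) ⟨
  d ℕ.+ (opp q t ℕ.+ suc t)       ≡⟨ cong (d ℕ.+_) (ℕ.+-suc (opp q t) t) ⟩
  d ℕ.+ suc (opp q t ℕ.+ t)       ≡⟨ ℕ.+-suc d (opp q t ℕ.+ t) ⟩
  suc (d ℕ.+ (opp q t ℕ.+ t))     ≡⟨ cong suc (ℕ.+-assoc d (opp q t) t) ⟨
  suc (d ℕ.+ opp q t ℕ.+ t)       ∎)

-- Row `t` is x^(q-1-t) times the polynomial, and column `j` holds the power x^(N-1-j). Left of the
-- band this power exceeds the degree of the row; right of the band it is below the multiplier.
sylRow-entry : ∀ c d q {t j N} → N ≡ d ℕ.+ q → t < q → j < N →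
  sylRow c d t j ≡ entry (suc d) c (λ _ → 0ℤ) (opp q t) (opp N j)
sylRow-entry c d q {t} {j} {N} N≡ t<q j<N with t ≤? j
... | no  t≰j = sym (entry-vanish (suc d) c (λ _ → 0ℤ) (opp q t) (opp N j)
      (ℕ.+-cancelʳ-≤ j (suc d ℕ.+ opp q t) (opp N j) (ℕ.≤-trans
        (subst (_≤ d ℕ.+ opp q t ℕ.+ t) (ℕ.+-suc (d ℕ.+ opp q t) j)
          (ℕ.+-monoʳ-≤ (d ℕ.+ opp q t) (ℕ.≰⇒> t≰j)))
        (ℕ.≤-reflexive (sym (opp-opp d q N≡ t<q j<N))))))
... | yes t≤j with (j ∸ t) ≤? d
...   | yes j∸t≤d = sym (begin
          entry (suc d) c (λ _ → 0ℤ) (opp q t) (opp N j)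
            ≡⟨ cong (entry (suc d) c (λ _ → 0ℤ) (opp q t))
                 (ℕ.+-cancelʳ-≡ j (opp N j) (opp q t ℕ.+ (d ∸ (j ∸ t))) (trans (opp-opp d q N≡ t<q j<N) offset)) ⟩
          entry (suc d) c (λ _ → 0ℤ) (opp q t) (opp q t ℕ.+ (d ∸ (j ∸ t)))
            ≡⟨ entry-zero-nodes (suc d) c (opp q t) (d ∸ (j ∸ t)) (s≤s (ℕ.m∸n≤m d (j ∸ t))) ⟩
          c (d ∸ (j ∸ t)) ∎)
  where
  offset : d ℕ.+ opp q t ℕ.+ t ≡ opp q t ℕ.+ (d ∸ (j ∸ t)) ℕ.+ j
  offset = begin
    d ℕ.+ opp q t ℕ.+ t                     ≡⟨ cong (ℕ._+ t) (ℕ.+-comm d (opp q t)) ⟩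
    opp q t ℕ.+ d ℕ.+ t                     ≡⟨ cong (λ x → opp q t ℕ.+ x ℕ.+ t) (ℕ.m∸n+n≡m j∸t≤d) ⟨
    opp q t ℕ.+ (d ∸ (j ∸ t) ℕ.+ (j ∸ t)) ℕ.+ t         ≡⟨ cong (ℕ._+ t) (ℕ.+-assoc (opp q t) (d ∸ (j ∸ t)) (j ∸ t)) ⟨
    opp q t ℕ.+ (d ∸ (j ∸ t)) ℕ.+ (j ∸ t) ℕ.+ t         ≡⟨ ℕ.+-assoc (opp q t ℕ.+ (d ∸ (j ∸ t))) (j ∸ t) t ⟩
    opp q t ℕ.+ (d ∸ (j ∸ t)) ℕ.+ (j ∸ t ℕ.+ t)       ≡⟨ cong (opp q t ℕ.+ (d ∸ (j ∸ t)) ℕ.+_) (ℕ.m∸n+n≡m t≤j) ⟩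
    opp q t ℕ.+ (d ∸ (j ∸ t)) ℕ.+ j               ∎
...   | no  j∸t≰d = sym (entry-below (suc d) c (λ _ → 0ℤ) (opp q t) (opp N j)
          (ℕ.+-cancelʳ-< j (opp N j) (opp q t) (subst (_< opp q t ℕ.+ j) (sym (opp-opp d q N≡ t<q j<N)) below)))
  where
  below : d ℕ.+ opp q t ℕ.+ t < opp q t ℕ.+ j
  below = subst₂ _<_
    (trans (sym (ℕ.+-assoc (opp q t) d t)) (cong (ℕ._+ t) (ℕ.+-comm (opp q t) d)))
    (cong (opp q t ℕ.+_) (ℕ.m∸n+n≡m t≤j))
    (ℕ.+-monoʳ-< (opp q t) (ℕ.+-monoˡ-< t (ℕ.≰⇒> j∸t≰d)))

resultant-newton : ∀ m n a b ε →
  resultant m n a b ≡ det (m ℕ.+ n) (Newton.newton m n (coeff m a) (coeff n b) (m ℕ.+ n) ε)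
resultant-newton m n a b ε = trans
  (det-cong (m ℕ.+ n) entries)
  (sym (Newton.det-newton m n (coeff m a) (coeff n b) (m ℕ.+ n) refl ε))
  where
  open Newton m n (coeff m a) (coeff n b)
  entries : ∀ i j → sylvester m n a b i j ≡ newton (m ℕ.+ n) (λ _ → 0ℤ) i j
  entries i j with toℕ i <? n
  ... | yes i<n = trans (sylRow-entry (coeff m a) m n refl i<n (toℕ<n j))
        (sym (trans (choose-< i<n)
          (cong (λ r → entry (suc m) (coeff m a) (λ _ → 0ℤ) r (opp (m ℕ.+ n) (toℕ j))) (choose-< i<n))))
  ... | no  i≮n = trans
        (sylRow-entry (coeff n b) n m (ℕ.+-comm m n) i∸n<m (toℕ<n j))
        (sym (trans (choose-≥ i≥n)
          (cong (λ r → entry (suc n) (coeff n b) (λ _ → 0ℤ) r (opp (m ℕ.+ n) (toℕ j)))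
            (trans (choose-≥ i≥n) opp≡))))
    where
    i≥n : n ≤ toℕ i
    i≥n = ℕ.≮⇒≥ i≮n
    opp≡ : opp (m ℕ.+ n) (toℕ i) ≡ opp m (toℕ i ∸ n)
    opp≡ = begin
      m ℕ.+ n ∸ suc (toℕ i)                ≡⟨ cong (λ x → m ℕ.+ n ∸ suc x) (ℕ.m∸n+n≡m i≥n) ⟨
      m ℕ.+ n ∸ (suc (toℕ i ∸ n) ℕ.+ n)    ≡⟨ cong₂ _∸_ (ℕ.+-comm m n) (ℕ.+-comm (suc (toℕ i ∸ n)) n) ⟩
      n ℕ.+ m ∸ (n ℕ.+ suc (toℕ i ∸ n))    ≡⟨ ℕ.[m+n]∸[m+o]≡n∸o n m (suc (toℕ i ∸ n)) ⟩
      m ∸ suc (toℕ i ∸ n)                  ∎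
    i∸n<m : toℕ i ∸ n < m
    i∸n<m = ℕ.+-cancelʳ-< n (toℕ i ∸ n) m (subst (_< m ℕ.+ n) (sym (ℕ.m∸n+n≡m i≥n)) (toℕ<n i))

-- Weighted divisibility of determinants

sumℕ : ∀ n → (Fin n → ℕ) → ℕ
sumℕ zero    h = 0
sumℕ (suc n) h = h zero ℕ.+ sumℕ n (h ∘ suc)

sumℕ-punchIn : ∀ n (h : Fin (suc n) → ℕ) j → sumℕ (suc n) h ≡ h j ℕ.+ sumℕ n (h ∘ punchIn j)
sumℕ-punchIn n       h zero    = refl
sumℕ-punchIn (suc n) h (suc j) = begin
  h zero ℕ.+ sumℕ (suc n) (h ∘ suc)
    ≡⟨ cong (h zero ℕ.+_) (sumℕ-punchIn n (h ∘ suc) j) ⟩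
  h zero ℕ.+ (h (suc j) ℕ.+ sumℕ n (h ∘ suc ∘ punchIn j))
    ≡⟨ exchange (h zero) (h (suc j)) (sumℕ n (h ∘ suc ∘ punchIn j)) ⟩
  h (suc j) ℕ.+ (h zero ℕ.+ sumℕ n (h ∘ suc ∘ punchIn j)) ∎
  where
  exchange : ∀ x y z → x ℕ.+ (y ℕ.+ z) ≡ y ℕ.+ (x ℕ.+ z)
  exchange = ℕSolver.solve-∀

sum< : (ℕ → ℕ) → ℕ → ℕ
sum< F zero    = 0
sum< F (suc k) = F k ℕ.+ sum< F k

sum<-cong : ∀ {F G : ℕ → ℕ} k → (∀ i → i < k → F i ≡ G i) → sum< F k ≡ sum< G k
sum<-cong zero    h = refl
sum<-cong (suc k) h = cong₂ ℕ._+_ (h k ℕ.≤-refl) (sum<-cong k λ i i<k → h i (ℕ.m≤n⇒m≤1+n i<k))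

sum<-+ : ∀ F G k → sum< (λ i → F i ℕ.+ G i) k ≡ sum< F k ℕ.+ sum< G k
sum<-+ F G zero    = refl
sum<-+ F G (suc k) = trans (cong (F k ℕ.+ G k ℕ.+_) (sum<-+ F G k))
  (interchange (F k) (G k) (sum< F k) (sum< G k))
  where
  interchange : ∀ a b c d → a ℕ.+ b ℕ.+ (c ℕ.+ d) ≡ a ℕ.+ c ℕ.+ (b ℕ.+ d)
  interchange = ℕSolver.solve-∀

sum<-const : ∀ c k → sum< (λ _ → c) k ≡ k ℕ.* c
sum<-const c zero    = refl
sum<-const c (suc k) = cong (c ℕ.+_) (sum<-const c k)

sum<-split : ∀ F k l → sum< F (k ℕ.+ l) ≡ sum< (λ i → F (i ℕ.+ l)) k ℕ.+ sum< F l
sum<-split F zero    l = refl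
sum<-split F (suc k) l = trans (cong (F (k ℕ.+ l) ℕ.+_) (sum<-split F k l))
  (sym (ℕ.+-assoc (F (k ℕ.+ l)) (sum< (λ i → F (i ℕ.+ l)) k) (sum< F l)))

term≤sum< : ∀ F {i} k → i < k → F i ≤ sum< F k
term≤sum< F {i} (suc k) i<1+k with i ℕ.≟ k
... | yes refl = ℕ.m≤m+n (F i) (sum< F i)
... | no  i≢k  = ℕ.≤-trans (term≤sum< F k (ℕ.≤∧≢⇒< (ℕ.≤-pred i<1+k) i≢k)) (ℕ.m≤n+m (sum< F k) (F k))

sum-opp : ∀ F N → sumℕ N (λ j → F (opp N (toℕ j))) ≡ sum< F N
sum-opp F zero    = refl
sum-opp F (suc N) = cong (F N ℕ.+_) (sum-opp F N)

sum-choose-opp : ∀ F n m → sumℕ (n ℕ.+ m) (λ i → F (choose n (toℕ i) (opp n (toℕ i)) (opp (n ℕ.+ m) (toℕ i)))) ≡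
  sum< F n ℕ.+ sum< F m
sum-choose-opp F zero    m = sum-opp F m
sum-choose-opp F (suc n) m = trans (cong (F n ℕ.+_) (sum-choose-opp F n m))
  (sym (ℕ.+-assoc (F n) (sum< F n) (sum< F m)))

*-mono-∣ : ∀ {a b x y} → a ∣ₛ x → b ∣ₛ y → a * b ∣ₛ x * y
*-mono-∣ {a} {b} {x} {y} a∣x b∣y = ∣ₛ-trans (*-monoˡ-∣ b a∣x) (*-monoʳ-∣ x b∣y)

∣0 : ∀ k → k ∣ₛ 0ℤ
∣0 k = divides 0ℤ refl

∣-sumFin : ∀ k n {f : Fin n → ℤ} → (∀ i → k ∣ₛ f i) → k ∣ₛ sumFin n f
∣-sumFin k zero    h = ∣0 k
∣-sumFin k (suc n) h = ∣m∣n⇒∣m+n (h zero) (∣-sumFin k n (h ∘ suc))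

module Powers (p : ℕ) where

  pw : ℕ → ℤ
  pw k = + (p ℕ.^ k)

  pw-+ : ∀ k l → pw (k ℕ.+ l) ≡ pw k * pw l
  pw-+ k l = trans (cong +_ (ℕ.^-distribˡ-+-* p k l)) (pos-* (p ℕ.^ k) (p ℕ.^ l))

  pw-mono : ∀ {k l} → k ≤ l → pw k ∣ₛ pw l
  pw-mono {k} {l} k≤l = divides (pw (l ∸ k)) (trans (cong pw (sym (ℕ.m∸n+n≡m k≤l))) (pw-+ (l ∸ k) k))

  -- Each product in the expansion takes one entry from every row and column, so the weights add up.
  -- Row weights multiply the entry because `u j - w i` may be negative.
  weighted-det : ∀ n (M : Matrix n n) (w u : Fin n → ℕ) → (∀ i j → pw (u j) ∣ₛ pw (w i) * M i j) →
    pw (sumℕ n u) ∣ₛ pw (sumℕ n w) * det n M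
  weighted-det zero    M w u h = divides 1ℤ refl
  weighted-det (suc n) M w u h = subst (pw (sumℕ (suc n) u) ∣ₛ_)
    (sum-* (suc n) (pw (sumℕ (suc n) w)) (λ j → sign (toℕ j) * (M zero j * minor j)))
    (∣-sumFin (pw (sumℕ (suc n) u)) (suc n) λ j →
      subst₂ _∣ₛ_
        (trans (sym (pw-+ (u j) (sumℕ n (u ∘ punchIn j)))) (cong pw (sym (sumℕ-punchIn n u j))))
        (trans (regroup (sign (toℕ j)) (pw (w zero)) (M zero j) (pw (sumℕ n (w ∘ suc))) (minor j))
          (cong (_* (sign (toℕ j) * (M zero j * minor j))) (sym (pw-+ (w zero) (sumℕ n (w ∘ suc))))))
        (∣n⇒∣m*n (sign (toℕ j)) (*-mono-∣ (h zero j)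
          (weighted-det n (λ k l → M (suc k) (punchIn j l)) (w ∘ suc) (u ∘ punchIn j)
            (λ k l → h (suc k) (punchIn j l))))))
    where
    minor : Fin (suc n) → ℤ
    minor j = det n (λ k l → M (suc k) (punchIn j l))
    regroup : ∀ s a x b d → s * ((a * x) * (b * d)) ≡ (a * b) * (s * (x * d))
    regroup = solve-∀

  -- `W` and `U` weigh exponents, not positions: multipliers have exponents below n in the rows of f
  -- and below m in the rows of g.
  resultant-divisible : ∀ m n a b ε (W U : ℕ → ℕ) →
    (∀ i j → pw (U j) ∣ₛ pw (W i) * entry (suc m) (coeff m a) ε i j) →
    (∀ i j → pw (U j) ∣ₛ pw (W i) * entry (suc n) (coeff n b) ε i j) →
    pw (sum< U (m ℕ.+ n)) ∣ₛ pw (sum< W n ℕ.+ sum< W m) * resultant m n a b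
  resultant-divisible m n a b ε W U hf hg = subst₂ _∣ₛ_
    (cong pw (sum-opp U (m ℕ.+ n)))
    (cong₂ (λ k r → pw k * r)
      (trans (cong (λ N → sumℕ N (λ i → W (rowIndex N (toℕ i)))) (ℕ.+-comm m n)) (sum-choose-opp W n m))
      (sym (resultant-newton m n a b ε)))
    (weighted-det (m ℕ.+ n) (newton (m ℕ.+ n) ε)
      (λ i → W (rowIndex (m ℕ.+ n) (toℕ i))) (λ j → U (opp (m ℕ.+ n) (toℕ j)))
      (λ i j → row (toℕ i) (rowIndex (m ℕ.+ n) (toℕ i)) (opp (m ℕ.+ n) (toℕ j))))
    where
    open Newton m n (coeff m a) (coeff n b)
    row : ∀ i r j → pw (U j) ∣ₛ pw (W r) * rowEntry ε i r j
    row i r j with i <? n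
    ... | yes i<n = subst (λ z → pw (U j) ∣ₛ pw (W r) * z) (sym (choose-< i<n)) (hf r j)
    ... | no  i≮n = subst (λ z → pw (U j) ∣ₛ pw (W r) * z) (sym (choose-≥ (ℕ.≮⇒≥ i≮n))) (hg r j)

  -- Sums of weights and the resulting bound

  module _ .{{_ : NonZero p}} where

    pw-cancel : ∀ k l {z} → pw (k ℕ.+ l) ∣ₛ pw k * z → pw l ∣ₛ z
    pw-cancel k l {z} h = *-cancelˡ-∣ (pw k) {{ℕ.m^n≢0 p k}} (subst (_∣ₛ pw k * z) (pw-+ k l) h)

    exponent-bound : ∀ A B v {r} → pw A ∣ₛ pw B * r → ¬ (pw (suc v) ∣ₛ r) → A ≤ B ℕ.+ v
    exponent-bound A B v h ∤ with A ≤? B ℕ.+ v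
    ... | yes A≤ = A≤
    ... | no  A≰ = contradiction
          (pw-cancel B (suc v) (∣ₛ-trans (pw-mono (subst (_≤ A) (sym (ℕ.+-suc B v)) (ℕ.≰⇒> A≰))) h)) ∤

    quotient-shift : ∀ b → (b ℕ.+ p) / p ≡ suc (b / p)
    quotient-shift b = trans (+-distrib-/-∣ʳ b (ℕ∣.∣-refl {p}))
      (trans (cong (b / p ℕ.+_) (n/n≡1 p)) (ℕ.+-comm (b / p) 1))

    deficit : ℕ → ℕ → ℕ
    deficit q b = q ∸ b / p

    -- The weights are q, ..., 1, each on a block of p indices, and 0 on the remaining r. Doubling
    -- avoids a division; shifting by p removes the first block.
    deficit-sum : ∀ q r → 2 ℕ.* sum< (deficit q) (r ℕ.+ q ℕ.* p) ≡ p ℕ.* q ℕ.* suc q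
    deficit-sum zero    r = trans
      (cong (2 ℕ.*_) (trans (sum<-cong (r ℕ.+ 0) (λ b _ → ℕ.0∸n≡0 (b / p))) (sum<-const 0 (r ℕ.+ 0))))
      (trans (cong (2 ℕ.*_) (ℕ.*-zeroʳ (r ℕ.+ 0))) (sym (cong (ℕ._* 1) (ℕ.*-zeroʳ p))))
    deficit-sum (suc q) r = begin
      2 ℕ.* sum< (deficit (suc q)) (r ℕ.+ (p ℕ.+ q ℕ.* p))
        ≡⟨ cong (λ N → 2 ℕ.* sum< (deficit (suc q)) N) (reassoc r p (q ℕ.* p)) ⟩
      2 ℕ.* sum< (deficit (suc q)) (r ℕ.+ q ℕ.* p ℕ.+ p)
        ≡⟨ cong (2 ℕ.*_) (sum<-split (deficit (suc q)) (r ℕ.+ q ℕ.* p) p) ⟩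
      2 ℕ.* (sum< (λ b → deficit (suc q) (b ℕ.+ p)) (r ℕ.+ q ℕ.* p) ℕ.+ sum< (deficit (suc q)) p)
        ≡⟨ cong₂ (λ x y → 2 ℕ.* (x ℕ.+ y))
             (sum<-cong (r ℕ.+ q ℕ.* p) (λ b _ → cong (suc q ∸_) (quotient-shift b)))
             (trans (sum<-cong p (λ b b<p → cong (suc q ∸_) (m<n⇒m/n≡0 b<p))) (sum<-const (suc q) p)) ⟩
      2 ℕ.* (sum< (deficit q) (r ℕ.+ q ℕ.* p) ℕ.+ p ℕ.* suc q)
        ≡⟨ ℕ.*-distribˡ-+ 2 (sum< (deficit q) (r ℕ.+ q ℕ.* p)) (p ℕ.* suc q) ⟩
      2 ℕ.* sum< (deficit q) (r ℕ.+ q ℕ.* p) ℕ.+ 2 ℕ.* (p ℕ.* suc q)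
        ≡⟨ cong (ℕ._+ 2 ℕ.* (p ℕ.* suc q)) (deficit-sum q r) ⟩
      p ℕ.* q ℕ.* suc q ℕ.+ 2 ℕ.* (p ℕ.* suc q)
        ≡⟨ collect p q ⟩
      p ℕ.* suc q ℕ.* suc (suc q) ∎
      where
      reassoc : ∀ x y z → x ℕ.+ (y ℕ.+ z) ≡ x ℕ.+ z ℕ.+ y
      reassoc = ℕSolver.solve-∀
      collect : ∀ p q → p ℕ.* q ℕ.* (1 ℕ.+ q) ℕ.+ 2 ℕ.* (p ℕ.* (1 ℕ.+ q)) ≡ p ℕ.* (1 ℕ.+ q) ℕ.* (2 ℕ.+ q)
      collect = ℕSolver.solve-∀

    -- The sums are p s (2s+1) for the columns and p s (s+1)/2 for each block of rows; the bounds on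
    -- m and n ensure that all positive weights occur.
    deficit-balance : ∀ s {m n} → s ℕ.* p ≤ m → s ℕ.* p ≤ n →
      sum< (deficit (s ℕ.+ s)) (m ℕ.+ n) ≡
      sum< (deficit s) n ℕ.+ sum< (deficit s) m ℕ.+ p ℕ.* s ℕ.* s
    deficit-balance s {m} {n} m≥ n≥ = ℕ.*-cancelˡ-≡ _ _ 2 (begin
      2 ℕ.* sum< (deficit (s ℕ.+ s)) (m ℕ.+ n)
        ≡⟨ cong (λ N → 2 ℕ.* sum< (deficit (s ℕ.+ s)) N) total ⟩
      2 ℕ.* sum< (deficit (s ℕ.+ s)) (m′ ℕ.+ n′ ℕ.+ (s ℕ.+ s) ℕ.* p)
        ≡⟨ deficit-sum (s ℕ.+ s) (m′ ℕ.+ n′) ⟩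
      p ℕ.* (s ℕ.+ s) ℕ.* suc (s ℕ.+ s)
        ≡⟨ identity p s ⟩
      p ℕ.* s ℕ.* suc s ℕ.+ p ℕ.* s ℕ.* suc s ℕ.+ 2 ℕ.* (p ℕ.* s ℕ.* s)
        ≡⟨ cong₂ (λ x y → x ℕ.+ y ℕ.+ 2 ℕ.* (p ℕ.* s ℕ.* s)) (half n≥) (half m≥) ⟩
      2 ℕ.* sum< (deficit s) n ℕ.+ 2 ℕ.* sum< (deficit s) m ℕ.+ 2 ℕ.* (p ℕ.* s ℕ.* s)
        ≡⟨ factor (sum< (deficit s) n) (sum< (deficit s) m) (p ℕ.* s ℕ.* s) ⟩
      2 ℕ.* (sum< (deficit s) n ℕ.+ sum< (deficit s) m ℕ.+ p ℕ.* s ℕ.* s) ∎)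
      where
      m′ n′ : ℕ
      m′ = m ∸ s ℕ.* p
      n′ = n ∸ s ℕ.* p
      half : ∀ {k} → s ℕ.* p ≤ k → p ℕ.* s ℕ.* suc s ≡ 2 ℕ.* sum< (deficit s) k
      half {k} k≥ = trans (sym (deficit-sum s (k ∸ s ℕ.* p)))
        (cong (λ N → 2 ℕ.* sum< (deficit s) N) (ℕ.m∸n+n≡m k≥))
      regroup : ∀ x y p s → (x ℕ.+ s ℕ.* p) ℕ.+ (y ℕ.+ s ℕ.* p) ≡ x ℕ.+ y ℕ.+ (s ℕ.+ s) ℕ.* p
      regroup = ℕSolver.solve-∀
      total : m ℕ.+ n ≡ m′ ℕ.+ n′ ℕ.+ (s ℕ.+ s) ℕ.* p
      total = trans (cong₂ ℕ._+_ (sym (ℕ.m∸n+n≡m m≥)) (sym (ℕ.m∸n+n≡m n≥))) (regroup m′ n′ p s)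
      identity : ∀ p s → p ℕ.* (s ℕ.+ s) ℕ.* (1 ℕ.+ (s ℕ.+ s)) ≡
        p ℕ.* s ℕ.* (1 ℕ.+ s) ℕ.+ p ℕ.* s ℕ.* (1 ℕ.+ s) ℕ.+ 2 ℕ.* (p ℕ.* s ℕ.* s)
      identity = ℕSolver.solve-∀
      factor : ∀ x y z → 2 ℕ.* x ℕ.+ 2 ℕ.* y ℕ.+ 2 ℕ.* z ≡ 2 ℕ.* (x ℕ.+ y ℕ.+ z)
      factor = ℕSolver.solve-∀

    -- β is the gain, column by column, over the divisibility that holds for all f and g with the
    -- given fixed divisor p^s.
    valuation-bound : ∀ m n a b ε s (β : ℕ → ℕ) {v} → s ℕ.* p ≤ m → s ℕ.* p ≤ n →
      (∀ i j → pw (deficit (s ℕ.+ s) j ℕ.+ β j) ∣ₛ pw (deficit s i) * entry (suc m) (coeff m a) ε i j) →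
      (∀ i j → pw (deficit (s ℕ.+ s) j ℕ.+ β j) ∣ₛ pw (deficit s i) * entry (suc n) (coeff n b) ε i j) →
      ¬ (pw (suc v) ∣ₛ resultant m n a b) →
      p ℕ.* s ℕ.* s ℕ.+ sum< β (m ℕ.+ n) ≤ v
    valuation-bound m n a b ε s β {v} m≥ n≥ hf hg ∤ = ℕ.+-cancelˡ-≤ D _ v
      (subst (_≤ D ℕ.+ v)
        (trans (sum<-+ (deficit (s ℕ.+ s)) β (m ℕ.+ n))
          (trans (cong (ℕ._+ sum< β (m ℕ.+ n)) (deficit-balance s m≥ n≥))
            (ℕ.+-assoc D (p ℕ.* s ℕ.* s) (sum< β (m ℕ.+ n)))))
        (exponent-bound (sum< (λ j → deficit (s ℕ.+ s) j ℕ.+ β j) (m ℕ.+ n)) D v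
          (resultant-divisible m n a b ε (deficit s) (λ j → deficit (s ℕ.+ s) j ℕ.+ β j) hf hg) ∤))
      where
      D : ℕ
      D = sum< (deficit s) n ℕ.+ sum< (deficit s) m

-- Divisibility of divided differences

cons : ℤ → (ℕ → ℤ) → ℕ → ℤ
cons x ε zero    = x
cons x ε (suc t) = ε t

Consecutive : (ℕ → ℤ) → Set
Consecutive ε = ∀ t → ε (suc t) ≡ ε t + 1ℤ

consecutive-difference : ∀ ε → Consecutive ε → ∀ t → ε t - ε 0 ≡ + t
consecutive-difference ε h zero    = x-x (ε 0)
  where
  x-x : ∀ x → x - x ≡ 0ℤ
  x-x = solve-∀
consecutive-difference ε h (suc t) = trans (cong (_- ε 0) (h t))
  (trans (move (ε t) (ε 0)) (trans (cong (_+ 1ℤ) (consecutive-difference ε h t)) (cong +_ (ℕ.+-comm t 1))))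
  where
  move : ∀ x y → x + 1ℤ - y ≡ (x - y) + 1ℤ
  move = solve-∀

module Bounds (p : ℕ) (p-prime : Prime p) where

  open Powers p

  instance
    p≢0 : NonZero p
    p≢0 = prime⇒nonZero p-prime

  pw-1 : ∀ {u} → + p ∣ₛ u → pw 1 ∣ₛ u
  pw-1 {u} = subst (λ q → + q ∣ₛ u) (sym (ℕ.*-identityʳ p))

  -- One power at a time: once p^k is split off `z`, Euclid's lemma moves the next factor p past
  -- `u`.
  pw-cancel-unit : ∀ k u z → ¬ (+ p ∣ₛ u) → pw k ∣ₛ u * z → pw k ∣ₛ z
  pw-cancel-unit zero    u z ∤ h = divides z (sym (*-identityʳ z))
  pw-cancel-unit (suc k) u z ∤ h with pw-cancel-unit k u z ∤ (∣ₛ-trans (pw-mono (ℕ.n≤1+n k)) h)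
  ... | divides q refl = subst (_∣ₛ q * pw k) (sym (pos-* p (p ℕ.^ k))) (*-monoˡ-∣ (pw k) p∣q)
    where
    p∣uq : + p ∣ₛ u * q
    p∣uq = *-cancelʳ-∣ (pw k) {{ℕ.m^n≢0 p k}}
      (subst₂ _∣ₛ_ (pos-* p (p ℕ.^ k)) (sym (*-assoc u q (pw k))) h)
    p∣q : + p ∣ₛ q
    p∣q with euclidsLemma ∣ u ∣ ∣ q ∣ p-prime (subst (p ℕ∣.∣_) (abs-* u q) (∣⇒∣ᵤ p∣uq))
    ... | inj₁ p∣u = contradiction (∣ᵤ⇒∣ p∣u) ∤
    ... | inj₂ p∣q = ∣ᵤ⇒∣ p∣q

  pw∣1⇒≡0 : ∀ t → pw t ∣ₛ 1ℤ → t ≡ 0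
  pw∣1⇒≡0 t h with ℕ.m^n≡1⇒n≡0∨m≡1 p t (ℕ∣.∣1⇒≡1 (∣⇒∣ᵤ h))
  ... | inj₁ t≡0 = t≡0
  ... | inj₂ p≡1 = contradiction p≡1 (ℕ.nonTrivial⇒≢1 {{prime⇒nonTrivial p-prime}})

  small∤ : ∀ {t} → 0 < t → t < p → ¬ (p ℕ∣.∣ t)
  small∤ {suc t} _ t<p p∣t = ℕ.<⇒≱ t<p (ℕ∣.∣⇒≤ p∣t)

  /-suc-≤ : ∀ l → suc l / p ≤ suc (l / p)
  /-suc-≤ l = ℕ.≤-trans (/-monoˡ-≤ p 1+l≤l+p) (ℕ.≤-reflexive (quotient-shift l))
    where
    1+l≤l+p : suc l ≤ l ℕ.+ p
    1+l≤l+p = subst (_≤ l ℕ.+ p) (ℕ.+-comm l 1) (ℕ.+-monoʳ-≤ l (ℕ.>-nonZero⁻¹ p))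

  /-suc-∤ : ∀ l → ¬ (p ℕ∣.∣ suc l) → suc l / p ≤ l / p
  /-suc-∤ l ∤ with suc l % p | m≡m%n+[m/n]*n (suc l) p
  ... | zero  | eq = contradiction (ℕ∣.divides (suc l / p) eq) ∤
  ... | suc r | eq = subst (_≤ l / p) (m*n/n≡m (suc l / p) p)
        (/-monoˡ-≤ p (subst (suc l / p ℕ.* p ≤_) (sym (ℕ.suc-injective eq)) (ℕ.m≤n+m (suc l / p ℕ.* p) r)))

  /-superadditive : ∀ i d → i / p ℕ.+ d / p ≤ (i ℕ.+ d) / p
  /-superadditive i d = subst (_≤ (i ℕ.+ d) / p) (m*n/n≡m (i / p ℕ.+ d / p) p)
    (/-monoˡ-≤ p (subst (_≤ i ℕ.+ d) (sym (ℕ.*-distribʳ-+ p (i / p) (d / p)))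
      (ℕ.+-mono-≤ (m/n*n≤m i p) (m/n*n≤m d p))))

  /-below : ∀ {l} → l < p → l / p ≡ 0
  /-below = m<n⇒m/n≡0

  -- At an index divisible by p one factor p is lost, and no more since the index is below p * p.
  divide-by-index : ∀ {s} → s ≤ p → ∀ d z → pw (s ∸ d / p) ∣ₛ + suc d * z → pw (s ∸ suc d / p) ∣ₛ z
  divide-by-index {s} s≤p d z divisible with p ℕ∣.∣? suc d
  ... | no  p∤1+d = ∣ₛ-trans (pw-mono (ℕ.∸-monoʳ-≤ s (/-monoˡ-≤ p (ℕ.n≤1+n d))))
        (pw-cancel-unit (s ∸ d / p) (+ suc d) z (p∤1+d ∘ ∣⇒∣ᵤ) divisible)
  ... | yes (ℕ∣.divides q 1+d≡qp) with s ≤? q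
  ...   | yes s≤q = subst (λ k → pw k ∣ₛ z)
          (sym (ℕ.m≤n⇒m∸n≡0 (subst (s ≤_) (sym 1+d/p≡q) s≤q))) (divides z (sym (*-identityʳ z)))
    where
    1+d/p≡q : suc d / p ≡ q
    1+d/p≡q = trans (cong (_/ p) 1+d≡qp) (m*n/n≡m q p)
  ...   | no  s≰q = subst (λ k → pw (s ∸ k) ∣ₛ z) (sym 1+d/p≡q)
          (pw-cancel-unit (s ∸ q) (+ q) z (q∤ ∘ ∣⇒∣ᵤ)
            (pw-cancel 1 (s ∸ q) (subst (pw (suc (s ∸ q)) ∣ₛ_) extract-p
              (∣ₛ-trans (pw-mono (ℕ.∸-monoʳ-< d/p<q (ℕ.<⇒≤ q<s))) divisible))))
    where
    1+d/p≡q : suc d / p ≡ q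
    1+d/p≡q = trans (cong (_/ p) 1+d≡qp) (m*n/n≡m q p)
    q<s : q < s
    q<s = ℕ.≰⇒> s≰q
    q>0 : 0 < q
    q>0 = ℕ.n≢0⇒n>0 λ q≡0 → ℕ.1+n≢0 (trans 1+d≡qp (cong (ℕ._* p) q≡0))
    q∤ : ¬ (p ℕ∣.∣ q)
    q∤ = small∤ q>0 (ℕ.<-≤-trans q<s s≤p)
    d/p<q : d / p < q
    d/p<q = m<n*o⇒m/o<n (subst (d <_) 1+d≡qp (ℕ.n<1+n d))
    reorder : ∀ q p z → (q * p) * z ≡ p * (q * z)
    reorder = solve-∀
    extract-p : + suc d * z ≡ pw 1 * (+ q * z)
    extract-p = trans (cong (λ t → + t * z) 1+d≡qp) (trans (cong (_* z) (pos-* q p))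
      (trans (reorder (+ q) (+ p) z) (cong (λ t → + t * (+ q * z)) (sym (ℕ.*-identityʳ p)))))

  module _ (L : ℕ) (c : ℕ → ℤ) (s : ℕ) where

    -- What membership of f in the s-th power of the ideal (p, x^p - x) implies at the nodes ε.
    Bounded : (ℕ → ℤ) → Set
    Bounded ε = ∀ d → pw (s ∸ d / p) ∣ₛ dd L c ε d

    difference-divisible : ∀ ε k d → pw k ∣ₛ dd L c (ε ∘ suc) d → pw k ∣ₛ dd L c ε d →
      pw k ∣ₛ (ε (suc d) - ε 0) * dd L c ε (suc d)
    difference-divisible ε k d h₁ h₀ =
      ∣m+n∣m⇒∣n {m = dd L c ε d} (subst (pw k ∣ₛ_) (dd-shift L c ε d) h₁) h₀

    -- At consecutive nodes the factor in `dd-shift` is d + 1, so each new divided difference is a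
    -- difference of two earlier ones divided by its index.
    bounded-consecutive : s ≤ p → (∀ ε → pw s ∣ₛ dd L c ε 0) → ∀ ε → Consecutive ε → Bounded ε
    bounded-consecutive s≤p values ε consec zero    =
      subst (λ q → pw (s ∸ q) ∣ₛ dd L c ε 0) (sym (0/n≡0 p)) (values ε)
    bounded-consecutive s≤p values ε consec (suc d) = divide-by-index s≤p d (dd L c ε (suc d))
      (subst (λ z → pw (s ∸ d / p) ∣ₛ z * dd L c ε (suc d)) (consecutive-difference ε consec (suc d))
        (difference-divisible ε (s ∸ d / p) d
          (bounded-consecutive s≤p values (ε ∘ suc) (consec ∘ suc) d)
          (bounded-consecutive s≤p values ε consec d)))

    -- The recurrence is read downwards from the degree, where the divided differences vanish.
    bounded-cons : ∀ x ε → (∀ l → p ℕ∣.∣ suc l → + p ∣ₛ ε l - x) → Bounded ε → Bounded (cons x ε)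
    bounded-cons x ε x≡ bounded d = descend L d (ℕ.m≤n+m L d)
      where
      η : ℕ → ℤ
      η = cons x ε
      descend : ∀ k l → L ≤ l ℕ.+ k → pw (s ∸ l / p) ∣ₛ dd L c η l
      descend zero    l L≤ = subst (pw (s ∸ l / p) ∣ₛ_)
        (sym (dd-vanish L c η l (subst (L ≤_) (ℕ.+-identityʳ l) L≤))) (∣0 (pw (s ∸ l / p)))
      descend (suc k) l L≤ = ∣m+n∣n⇒∣m {m = dd L c η l}
        (subst (pw (s ∸ l / p) ∣ₛ_) (dd-shift L c η l) (bounded l)) product
        where
        next : pw (s ∸ suc l / p) ∣ₛ dd L c η (suc l)
        next = descend k (suc l) (subst (L ≤_) (ℕ.+-suc l k) L≤)
        product : pw (s ∸ l / p) ∣ₛ (ε l - x) * dd L c η (suc l)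
        -- The exponent drops from l to l + 1 only if p divides l + 1, and exactly then the factor
        -- `ε l - x` supplies the lost p.
        product with p ℕ∣.∣? suc l
        ... | yes p∣ = ∣ₛ-trans (pw-mono weaken) (subst (_∣ₛ (ε l - x) * dd L c η (suc l))
              (sym (pw-+ 1 (s ∸ suc l / p))) (*-mono-∣ (pw-1 (x≡ l p∣)) next))
          where
          weaken : s ∸ l / p ≤ suc (s ∸ suc l / p)
          weaken = ℕ.≤-trans (ℕ.m≤n+m∸n (s ∸ l / p) 1) (s≤s (ℕ.≤-trans
            (ℕ.≤-reflexive (trans (ℕ.∸-+-assoc s (l / p) 1) (cong (s ∸_) (ℕ.+-comm (l / p) 1))))
            (ℕ.∸-monoʳ-≤ s (/-suc-≤ l))))
        ... | no  p∤ = ∣n⇒∣m*n (ε l - x) (∣ₛ-trans (pw-mono (ℕ.∸-monoʳ-≤ s (/-suc-∤ l p∤))) next)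

    -- Row i of the matrix sees only the nodes from `ε i` on.
    EventuallyBounded : (ℕ → ℤ) → Set
    EventuallyBounded ε = ∀ i → Bounded (λ t → ε (i ℕ.+ t))

    ∸-split : ∀ α β → s ℕ.+ s ∸ (α ℕ.+ β) ≤ (s ∸ α) ℕ.+ (s ∸ β)
    ∸-split α β = ℕ.m≤n+o⇒m∸n≤o (s ℕ.+ s) (α ℕ.+ β) (ℕ.≤-trans
      (ℕ.+-mono-≤ (ℕ.m≤n+m∸n s α) (ℕ.m≤n+m∸n s β))
      (ℕ.≤-reflexive (interchange α (s ∸ α) β (s ∸ β))))
      where
      interchange : ∀ a b c d → a ℕ.+ b ℕ.+ (c ℕ.+ d) ≡ a ℕ.+ c ℕ.+ (b ℕ.+ d)
      interchange = ℕSolver.solve-∀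

    entry-zero-or-window : ∀ ε i j (P : ℕ → ℤ → Set) → P j 0ℤ →
      (∀ d → P (i ℕ.+ d) (dd L c (λ t → ε (i ℕ.+ t)) d)) → P j (entry L c ε i j)
    entry-zero-or-window ε i j P P0 Pd with i ≤? j
    ... | no  i≰j = subst (P j) (sym (entry-below L c ε i j (ℕ.≰⇒> i≰j))) P0
    ... | yes i≤j = subst (λ j → P j (entry L c ε i j)) (ℕ.m+[n∸m]≡n i≤j)
          (subst (P (i ℕ.+ (j ∸ i))) (sym (entry-window L c ε i (j ∸ i))) (Pd (j ∸ i)))

    -- Since ⌊i/p⌋ + ⌊d/p⌋ ≤ ⌊(i+d)/p⌋, the column weight at i + d is at most the row weight at i
    -- plus the exponent s - ⌊d/p⌋ of the entry.
    weight-default : ∀ ε → EventuallyBounded ε → ∀ i j →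
      pw (deficit (s ℕ.+ s) j) ∣ₛ pw (deficit s i) * entry L c ε i j
    weight-default ε bounded i j = entry-zero-or-window ε i j
      (λ j z → pw (deficit (s ℕ.+ s) j) ∣ₛ pw (deficit s i) * z)
      (∣n⇒∣m*n (pw (deficit s i)) (∣0 (pw (deficit (s ℕ.+ s) j))))
      λ d → ∣ₛ-trans
        (pw-mono (ℕ.≤-trans (ℕ.∸-monoʳ-≤ (s ℕ.+ s) (/-superadditive i d)) (∸-split (i / p) (d / p))))
        (subst (_∣ₛ pw (deficit s i) * dd L c (λ t → ε (i ℕ.+ t)) d) (sym (pw-+ (deficit s i) (deficit s d)))
          (*-monoʳ-∣ (pw (deficit s i)) (bounded i d)))

    weight-first : ∀ ε e → pw (s ℕ.+ e) ∣ₛ dd L c ε 0 → ∀ i →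
      pw (deficit (s ℕ.+ s) 0 ℕ.+ e) ∣ₛ pw (deficit s i) * entry L c ε i 0
    weight-first ε e h (suc i) = ∣n⇒∣m*n (pw (deficit s (suc i))) (∣0 (pw (deficit (s ℕ.+ s) 0 ℕ.+ e)))
    weight-first ε e h zero    = subst₂ (λ k z → pw k ∣ₛ pw z * dd L c ε 0)
      (trans (sym (ℕ.+-assoc s s e)) (cong (λ q → (s ℕ.+ s ∸ q) ℕ.+ e) (sym (0/n≡0 p))))
      (cong (s ∸_) (sym (0/n≡0 p)))
      (subst (_∣ₛ pw s * dd L c ε 0) (sym (pw-+ s (s ℕ.+ e))) (*-monoʳ-∣ (pw s) h))

-- The valuation of the resultant

-- Column gains for `valuation-bound`: `first` at the point of maximal valuation, `spike` at the
-- nearby point.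
first : ℕ → ℕ → ℕ
first e zero    = e
first e (suc _) = 0

spike : ℕ → ℕ → ℕ
spike k j with j ℕ.≟ k
... | yes _ = 1
... | no  _ = 0

spike-at : ∀ k → spike k k ≡ 1
spike-at k with k ℕ.≟ k
... | yes _   = refl
... | no  k≢k = contradiction refl k≢k

sum-first : ∀ e {N} → 0 < N → e ≤ sum< (first e) N
sum-first e {N} = term≤sum< (first e) N

sum-first-spike : ∀ e k {N} → 0 < k → k < N → e ℕ.+ 1 ≤ sum< (λ j → first e j ℕ.+ spike k j) N
sum-first-spike e k {N} 0<k k<N = subst (e ℕ.+ 1 ≤_) (sym (sum<-+ (first e) (spike k) N))
  (ℕ.+-mono-≤ (sum-first e (ℕ.<-trans 0<k k<N))
    (subst (_≤ sum< (spike k) N) (spike-at k) (term≤sum< (spike k) N k<N)))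

module Nodes (p : ℕ) (p-prime : Prime p) where

  open Powers p
  open Bounds p p-prime

  tail : ℤ → ℕ → ℤ
  tail x t = x - + p + 1ℤ + + t

  -- n, x-p+1, x-p+2, …: the node at index p is x.
  nodes : ℤ → ℤ → ℕ → ℤ
  nodes n x = cons n (tail x)

  tail-suc : ∀ x t → tail x (suc t) ≡ tail x t + 1ℤ
  tail-suc x t = trans (cong (λ z → x - + p + 1ℤ + + z) (ℕ.+-comm 1 t)) (assoc x (+ p) (+ t))
    where
    assoc : ∀ x p t → x - p + 1ℤ + (t + 1ℤ) ≡ x - p + 1ℤ + t + 1ℤ
    assoc = solve-∀

  tail-minus : ∀ x y t → tail x t - y ≡ (x - y) + (+ suc t - + p)
  tail-minus x y t = regroup x y (+ p) (+ t)
    where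
    regroup : ∀ x y p t → x - p + 1ℤ + t - y ≡ (x - y) + ((1ℤ + t) - p)
    regroup = solve-∀

  nodes-p : ∀ n x → nodes n x p ≡ x
  nodes-p n x = subst (λ q → nodes n x q ≡ x) (ℕ.suc-pred p)
    (trans (cong (λ q → x - + q + 1ℤ + + ℕ.pred p) (sym (ℕ.suc-pred p))) (cancel x (+ ℕ.pred p)))
    where
    cancel : ∀ x t → x - (1ℤ + t) + 1ℤ + t ≡ x
    cancel = solve-∀

  0<p : 0 < p
  0<p = ℕ.>-nonZero⁻¹ p

  p∣p : + p ∣ₛ + p
  p∣p = ∣ₛ-refl

  module Monic (m : ℕ) (a : Fin m → ℤ) (s : ℕ) where

    L : ℕ
    L = suc m

    c : ℕ → ℤ
    c = coeff m a

    leading : ∀ ε → dd L c ε m ≡ 1ℤ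
    leading ε = trans (dd-leading m c ε) (coeff-monic m a)

    -- A monic polynomial of degree 0 is 1, which no positive power of p divides.
    degree-positive : ∀ {k} x → pw (suc k) ∣ₛ eval m a x → 0 < m
    degree-positive {k} x h = ℕ.n≢0⇒n>0 λ m≡0 → ℕ.1+n≢0 (pw∣1⇒≡0 (suc k)
      (subst (pw (suc k) ∣ₛ_) (trans (sym (dd-value L c (λ _ → x)))
        (trans (cong (dd L c (λ _ → x)) (sym m≡0)) (leading (λ _ → x)))) h))

    module _ (s≤p : s ≤ p) (values : ∀ x → pw s ∣ₛ eval m a x) where

      values′ : ∀ ε → pw s ∣ₛ dd L c ε 0
      values′ ε = subst (pw s ∣ₛ_) (sym (dd-value L c ε)) (values (ε 0))

      tail-bounded : ∀ x i → Bounded L c s (λ t → tail x (i ℕ.+ t))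
      tail-bounded x i = bounded-consecutive L c s s≤p values′ (λ t → tail x (i ℕ.+ t))
        λ t → trans (cong (tail x) (ℕ.+-suc i t)) (tail-suc x (i ℕ.+ t))

      -- After the first node the nodes are consecutive integers. Those at indices divisible by p
      -- are congruent to x, hence to n, as `bounded-cons` requires.
      nodes-bounded : ∀ n x → + p ∣ₛ x - n → EventuallyBounded L c s (nodes n x)
      nodes-bounded n x p∣x-n (suc i) = tail-bounded x i
      nodes-bounded n x p∣x-n zero    = bounded-cons L c s n (tail x)
        (λ l p∣1+l → subst (+ p ∣ₛ_) (sym (tail-minus x n l))
          (∣m∣n⇒∣m+n p∣x-n (∣m∣n⇒∣m-n {m = + suc l} (∣ᵤ⇒∣ p∣1+l) p∣p)))
        (tail-bounded x 0)

      -- The divided difference of order m is the leading coefficient 1, so its exponent s - ⌊m/p⌋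
      -- must be 0.
      degree-bound : s ℕ.* p ≤ m
      degree-bound = ℕ.≤-trans (ℕ.*-monoˡ-≤ p {s} {m / p} (ℕ.m∸n≡0⇒m≤n (pw∣1⇒≡0 (s ∸ m / p)
        (subst (pw (s ∸ m / p) ∣ₛ_) (leading (tail 0ℤ)) (tail-bounded 0ℤ 0 m))))) (m/n*n≤m m p)

      weights-first : ∀ n x → + p ∣ₛ x - n → ∀ e → pw (s ℕ.+ e) ∣ₛ eval m a n → ∀ i j →
        pw (deficit (s ℕ.+ s) j ℕ.+ first e j) ∣ₛ pw (deficit s i) * entry L c (nodes n x) i j
      weights-first n x p∣x-n e h i zero    = weight-first L c s (nodes n x) e
        (subst (pw (s ℕ.+ e) ∣ₛ_) (sym (dd-value L c (nodes n x))) h) i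
      weights-first n x p∣x-n e h i (suc j) =
        subst (λ k → pw k ∣ₛ pw (deficit s i) * entry L c (nodes n x) i (suc j))
          (sym (ℕ.+-identityʳ (deficit (s ℕ.+ s) (suc j))))
          (weight-default L c s (nodes n x) (nodes-bounded n x p∣x-n) i (suc j))

  module Pair (m : ℕ) (a : Fin m → ℤ) (s′ : ℕ) (s≤p : suc s′ ≤ p)
              (values : ∀ x → pw (suc s′) ∣ₛ eval m a x)
              (n x : ℤ) (e : ℕ) (x-n≡ : x - n ≡ pw (suc e)) where

    s : ℕ
    s = suc s′

    open Monic m a s

    -- `η` starts with x, n, so `dd L c η 1` is the difference quotient f[x, n].
    ε η : ℕ → ℤ
    ε = nodes n x
    η = cons x ε

    p∣x-n : + p ∣ₛ x - n
    p∣x-n = subst (+ p ∣ₛ_) (sym (trans x-n≡ (pos-* p (p ℕ.^ e)))) (∣m⇒∣m*n (pw e) p∣p)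

    bounded : EventuallyBounded L c s ε
    bounded = nodes-bounded s≤p values n x p∣x-n

    recurrence : ∀ l → dd L c ε l ≡ dd L c η l + (ε l - x) * dd L c η (suc l)
    recurrence l = dd-shift L c η l

    -- Both sides are the divided difference at the nodes n, x-p+1, …, x-1, x, up to order.
    rotate : dd L c ε p ≡ dd L c η p
    rotate = trans (recurrence p) (trans
      (cong (λ y → dd L c η p + (y - x) * dd L c η (suc p)) (nodes-p n x))
      (vanish (dd L c η p) x (dd L c η (suc p))))
      where
      vanish : ∀ d x z → d + (x - x) * z ≡ d
      vanish = solve-∀

    n-x≡ : n - x ≡ - pw (suc e)
    n-x≡ = trans (flip n x) (cong -_ x-n≡)
      where
      flip : ∀ n x → n - x ≡ - (x - n)
      flip = solve-∀

    bounded-below-p : ∀ {l} → l < p → pw s ∣ₛ dd L c ε l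
    bounded-below-p {l} l<p = subst (λ q → pw (s ∸ q) ∣ₛ dd L c ε l) (/-below l<p) (bounded 0 l)

    -- The recurrence is read downwards from `rotate`, where p^(s-1) is known; on the way the
    -- differences at `ε` of order below p are divisible by p^s.
    quotient-divisible : pw s′ ∣ₛ dd L c η 1
    quotient-divisible = descend (ℕ.pred p) 0 (ℕ.suc-pred p)
      where
      descend : ∀ k l → suc l ℕ.+ k ≡ p → pw s′ ∣ₛ dd L c η (suc l)
      descend zero    l eq = subst (λ q → pw s′ ∣ₛ dd L c η q) (trans (sym eq) (ℕ.+-identityʳ (suc l)))
        (subst (pw s′ ∣ₛ_) rotate (subst (λ q → pw (s ∸ q) ∣ₛ dd L c ε p) (n/n≡1 p) (bounded 0 p)))
      descend (suc k) l eq = ∣m+n∣n⇒∣m {m = dd L c η (suc l)}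
        (subst (pw s′ ∣ₛ_) (recurrence (suc l)) (∣ₛ-trans (pw-mono (ℕ.n≤1+n s′)) (bounded-below-p 1+l<p)))
        (∣n⇒∣m*n (ε (suc l) - x) (descend k (suc l) (trans (sym (ℕ.+-suc (suc l) k)) eq)))
        where
        1+l<p : suc l < p
        1+l<p = subst (suc l <_) eq (ℕ.m<m+n (suc l) (s≤s z≤n))

    -- f(n) = f(x) + (n - x) f[x, n], and p^(e+1) and p^(s-1) divide the two factors of the product.
    lower : pw (suc e ℕ.+ s′) ∣ₛ eval m a n → pw (suc e ℕ.+ s′) ∣ₛ eval m a x
    lower h = subst (pw (suc e ℕ.+ s′) ∣ₛ_) (dd-value L c η)
      (∣m+n∣n⇒∣m {m = dd L c η 0}
        (subst (pw (suc e ℕ.+ s′) ∣ₛ_) (trans (sym (dd-value L c ε)) (recurrence 0)) h)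
        (subst₂ (λ k y → k ∣ₛ y * dd L c η 1) (sym (pw-+ (suc e) s′)) (sym n-x≡)
          (*-mono-∣ (∣m⇒∣-m {m = pw (suc e)} ∣ₛ-refl) quotient-divisible)))

    module _ (hₙ : pw (suc e ℕ.+ s) ∣ₛ eval m a n) (hₓ : pw (suc e ℕ.+ s) ∣ₛ eval m a x) where

      -- Now the recurrence is read upwards: p^s divides f[x, n] because p^(e+1+s) divides f(x) -
      -- f(n), and the factors l + 1 - p met below order p are prime to p.
      ascend : ∀ l → l < p → pw s ∣ₛ dd L c η (suc l)
      ascend zero    l<p = pw-cancel (suc e) s (subst (λ y → pw (suc e ℕ.+ s) ∣ₛ y * dd L c η 1) x-n≡
        (subst (pw (suc e ℕ.+ s) ∣ₛ_) difference (∣m∣n⇒∣m-n hₓ hₙ)))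
        where
        negate : ∀ f n x z → f - (f + (n - x) * z) ≡ (x - n) * z
        negate = solve-∀
        difference : eval m a x - eval m a n ≡ (x - n) * dd L c η 1
        difference = trans (cong₂ _-_ (sym (dd-value L c η)) (trans (sym (dd-value L c ε)) (recurrence 0)))
          (negate (dd L c η 0) n x (dd L c η 1))
      ascend (suc l) 1+l<p = pw-cancel-unit s (ε (suc l) - x) (dd L c η (suc (suc l))) unit
        (∣m+n∣m⇒∣n {m = dd L c η (suc l)}
          (subst (pw s ∣ₛ_) (recurrence (suc l)) (bounded-below-p 1+l<p))
          (ascend l (ℕ.<-trans (ℕ.n<1+n l) 1+l<p)))
        where
        restore : ∀ x t p → (x - x) + (t - p) + p ≡ t
        restore = solve-∀
        unit : ¬ (+ p ∣ₛ ε (suc l) - x)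
        unit p∣ = small∤ (s≤s z≤n) 1+l<p (∣⇒∣ᵤ (subst (+ p ∣ₛ_)
          (trans (cong (_+ + p) (tail-minus x x l)) (restore x (+ suc l) (+ p)))
          (∣m∣n⇒∣m+n p∣ p∣p)))

      top-divisible : pw s ∣ₛ dd L c ε p
      top-divisible = subst (pw s ∣ₛ_) (sym rotate)
        (subst (λ q → pw s ∣ₛ dd L c η q) (ℕ.suc-pred p) (ascend (ℕ.pred p) (ℕ.≤-reflexive (ℕ.suc-pred p))))

      product : ∀ {k l z} → pw l ∣ₛ z → pw (k ℕ.+ l) ∣ₛ pw k * z
      product {k} {l} {z} h = subst (_∣ₛ pw k * z) (sym (pw-+ k l)) (*-monoʳ-∣ (pw k) h)

      -- One more than the default 2s - 1. Row 0 has `top-divisible`; rows strictly between 0 and p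
      -- have order below p, with weight and exponent s; row p has weight s - 1 and the entry f(x),
      -- divisible by p^(s+1); later rows are zero.
      weight-p : ∀ i → pw (s ℕ.+ s) ∣ₛ pw (deficit s i) * entry L c ε i p
      weight-p zero = subst (λ q → pw (s ℕ.+ s) ∣ₛ pw (s ∸ q) * dd L c ε p) (sym (0/n≡0 p)) (product {s} {s} top-divisible)
      weight-p (suc i) with suc i <? p
      ... | yes i<p = subst (λ z → pw (s ℕ.+ s) ∣ₛ pw (deficit s (suc i)) * z)
            (trans (sym (entry-window L c ε (suc i) (p ∸ suc i)))
              (cong (entry L c ε (suc i)) (ℕ.m+[n∸m]≡n (ℕ.<⇒≤ i<p))))
            (subst₂ (λ q r → pw ((s ∸ q) ℕ.+ (s ∸ r)) ∣ₛ pw (deficit s (suc i)) * dd L c (λ t → ε (suc i ℕ.+ t)) (p ∸ suc i))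
              (/-below i<p) (/-below (ℕ.∸-monoʳ-< {p} {suc i} {0} (s≤s z≤n) (ℕ.<⇒≤ i<p)))
              (product {deficit s (suc i)} (bounded (suc i) (p ∸ suc i))))
      ... | no  i≮p with suc i ℕ.≟ p
      ...   | no  i≢p = subst (λ z → pw (s ℕ.+ s) ∣ₛ pw (deficit s (suc i)) * z)
              (sym (entry-below L c ε (suc i) p (ℕ.≤∧≢⇒< (ℕ.≮⇒≥ i≮p) (i≢p ∘ sym))))
              (∣n⇒∣m*n (pw (deficit s (suc i))) (∣0 (pw (s ℕ.+ s))))
      ...   | yes i≡p = subst (λ q → pw (s ℕ.+ s) ∣ₛ pw (deficit s q) * entry L c ε q p) (sym i≡p)
              (subst₂ (λ q z → pw (s ℕ.+ s) ∣ₛ pw (s ∸ q) * z) (sym (n/n≡1 p)) (sym corner)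
                (subst (λ k → pw k ∣ₛ pw s′ * eval m a x) (ℕ.+-suc s′ s)
                  (product {s′} (∣ₛ-trans (pw-mono (s≤s (ℕ.m≤n+m s e))) hₓ))))
        where
        corner : entry L c ε p p ≡ eval m a x
        corner = trans (cong (entry L c ε p) (sym (ℕ.+-identityʳ p))) (trans (entry-window L c ε p 0)
          (trans (dd-value L c (λ t → ε (p ℕ.+ t)))
            (cong (eval m a) (trans (cong ε (ℕ.+-identityʳ p)) (nodes-p n x)))))

      weights-first-spike : ∀ d → pw (s ℕ.+ d) ∣ₛ eval m a n → ∀ i j →
        pw (deficit (s ℕ.+ s) j ℕ.+ (first d j ℕ.+ spike p j)) ∣ₛ pw (deficit s i) * entry L c ε i j
      weights-first-spike d h i j with j ℕ.≟ p
      ... | yes j≡p = subst (λ j → pw (deficit (s ℕ.+ s) j ℕ.+ (first d j ℕ.+ 1)) ∣ₛ pw (deficit s i) * entry L c ε i j)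
            (sym j≡p) (subst (λ k → pw k ∣ₛ pw (deficit s i) * entry L c ε i p) (sym exponent) (weight-p i))
        where
        first-p : first d p ≡ 0
        first-p = cong (first d) (sym (ℕ.suc-pred p))
        exponent : deficit (s ℕ.+ s) p ℕ.+ (first d p ℕ.+ 1) ≡ s ℕ.+ s
        exponent = trans (cong₂ (λ q f → (s ℕ.+ s ∸ q) ℕ.+ (f ℕ.+ 1)) (n/n≡1 p) first-p)
          (ℕ.m∸n+n≡m {s ℕ.+ s} {1} (s≤s z≤n))
      ... | no  _   = subst (λ f → pw (deficit (s ℕ.+ s) j ℕ.+ f) ∣ₛ pw (deficit s i) * entry L c ε i j)
            (sym (ℕ.+-identityʳ (first d j))) (weights-first s≤p values n x p∣x-n d h i j)

  -- The case s = 0: all deficits vanish and only columns 0 and 1 carry gains, so the nodes after n,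
  -- x default to 0.
  module FlatPair (m : ℕ) (a : Fin m → ℤ) (n x : ℤ) (k : ℕ) (x-n≡ : x - n ≡ pw k) where

    open Monic m a 0

    ε : ℕ → ℤ
    ε = cons n (cons x (λ _ → 0ℤ))

    recurrence : eval m a x ≡ eval m a n + pw k * dd L c ε 1
    recurrence = trans (sym (dd-value L c (ε ∘ suc))) (trans (dd-shift L c ε 0)
      (cong₂ (λ f y → f + y * dd L c ε 1) (dd-value L c ε) x-n≡))

    lower : pw k ∣ₛ eval m a n → pw k ∣ₛ eval m a x
    lower h = subst (pw k ∣ₛ_) (sym recurrence) (∣m∣n⇒∣m+n h (∣m⇒∣m*n (dd L c ε 1) ∣ₛ-refl))

    weights-first-spike : ∀ S → pw S ∣ₛ eval m a n → pw (suc k) ∣ₛ eval m a n → pw (suc k) ∣ₛ eval m a x →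
      ∀ i j → pw (deficit 0 j ℕ.+ (first S j ℕ.+ spike 1 j)) ∣ₛ pw (deficit 0 i) * entry L c ε i j
    weights-first-spike S hS hₙ hₓ i j = subst₂ (λ q r → pw (q ℕ.+ (first S j ℕ.+ spike 1 j)) ∣ₛ pw r * entry L c ε i j)
      (sym (ℕ.0∸n≡0 (j / p))) (sym (ℕ.0∸n≡0 (i / p))) (∣n⇒∣m*n (pw 0) (column i j))
      where
      column : ∀ i j → pw (first S j ℕ.+ spike 1 j) ∣ₛ entry L c ε i j
      column zero          zero          = subst₂ (λ q z → pw q ∣ₛ z) (sym (ℕ.+-identityʳ S)) (sym (dd-value L c ε)) hS
      column (suc i)       zero          = ∣0 (pw (S ℕ.+ 0))
      -- p^(k+1) divides f(x) - f(n) = p^k f[n, x], so p divides f[n, x].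
      column zero          (suc zero)    = pw-cancel k 1 (subst (λ q → pw q ∣ₛ pw k * dd L c ε 1) (ℕ.+-comm 1 k)
        (∣m+n∣m⇒∣n {m = eval m a n} (subst (pw (suc k) ∣ₛ_) recurrence hₓ) hₙ))
      column (suc zero)    (suc zero)    = subst (pw 1 ∣ₛ_) (sym (dd-value L c (ε ∘ suc)))
        (∣ₛ-trans (pw-mono (s≤s (z≤n {k}))) hₓ)
      column (suc (suc i)) (suc zero)    = ∣0 (pw 1)
      column i             (suc (suc j)) = divides (entry L c ε i (suc (suc j))) (sym (*-identityʳ _))

  -- If p^(k+1) also divided both values at x, the gain at the column of x would add to the gain S -
  -- s at column 0. The last component keeps this bound for comparison with the assumed equality.
  close-point : ∀ m n a b s k S {v} x₀ → s ≤ p → s ≤ k → k < S →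
    (∀ x → pw s ∣ₛ eval m a x) → (∀ x → pw s ∣ₛ eval n b x) →
    pw S ∣ₛ eval m a x₀ → pw S ∣ₛ eval n b x₀ →
    ¬ (pw (suc v) ∣ₛ resultant m n a b) →
    ∃ λ x → ((pw k ∣ₛ eval m a x) × (pw k ∣ₛ eval n b x)) ×
      (pw (suc k) ∣ₛ eval m a x → pw (suc k) ∣ₛ eval n b x → p ℕ.* s ℕ.* s ℕ.+ (S ∸ s ℕ.+ 1) ≤ v)
  close-point m n a b zero     k (suc S) {v} x₀ _   _   k<S hf hg fS gS ∤ =
    x , (F.lower (weaken fS) , G.lower (weaken gS)) , λ fx gx →
      ℕ.≤-trans (ℕ.+-monoʳ-≤ (p ℕ.* 0 ℕ.* 0) (sum-first-spike (suc S) 1 (s≤s z≤n)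
          (ℕ.+-mono-≤ (Monic.degree-positive m a 0 {S} x₀ fS) (Monic.degree-positive n b 0 {S} x₀ gS))))
        (valuation-bound m n a b F.ε 0 (λ j → first (suc S) j ℕ.+ spike 1 j) z≤n z≤n
          (F.weights-first-spike (suc S) fS (∣ₛ-trans (pw-mono k<S) fS) fx)
          (G.weights-first-spike (suc S) gS (∣ₛ-trans (pw-mono k<S) gS) gx) ∤)
    where
    x : ℤ
    x = x₀ + pw k
    x-x₀≡ : x - x₀ ≡ pw k
    x-x₀≡ = cancel x₀ (pw k)
      where
      cancel : ∀ x y → x + y - x ≡ y
      cancel = solve-∀
    module F = FlatPair m a x₀ x k x-x₀≡
    module G = FlatPair n b x₀ x k x-x₀≡
    weaken : ∀ {z} → pw (suc S) ∣ₛ z → pw k ∣ₛ z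
    weaken = ∣ₛ-trans (pw-mono (ℕ.<⇒≤ k<S))
  close-point m n a b (suc s′) k S {v} x₀ s≤p s≤k k<S hf hg fS gS ∤ =
    x , (lowered F.lower fS , lowered G.lower gS) , λ fx gx →
      ℕ.≤-trans (ℕ.+-monoʳ-≤ (p ℕ.* s ℕ.* s) (sum-first-spike (S ∸ s) p 0<p p<m+n))
        (valuation-bound m n a b F.ε s (λ j → first (S ∸ s) j ℕ.+ spike p j) sp≤m sp≤n
          (F.weights-first-spike (raised fS) (retype fx) (S ∸ s) (split fS))
          (G.weights-first-spike (raised gS) (retype gx) (S ∸ s) (split gS)) ∤)
    where
    s e : ℕ
    s = suc s′
    -- With x - x₀ = p^(e+1) and difference quotients divisible by p^(s-1), the values change by
    -- multiples of p^k.
    e = k ∸ s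
    x : ℤ
    x = x₀ + pw (suc e)
    x-x₀≡ : x - x₀ ≡ pw (suc e)
    x-x₀≡ = cancel x₀ (pw (suc e))
      where
      cancel : ∀ x y → x + y - x ≡ y
      cancel = solve-∀
    module F = Pair m a s′ s≤p hf x₀ x e x-x₀≡
    module G = Pair n b s′ s≤p hg x₀ x e x-x₀≡
    k≡ : suc e ℕ.+ s′ ≡ k
    k≡ = trans (sym (ℕ.+-suc e s′)) (ℕ.m∸n+n≡m s≤k)
    retype : ∀ {z} → pw (suc k) ∣ₛ z → pw (suc e ℕ.+ s) ∣ₛ z
    retype {z} = subst (λ l → pw l ∣ₛ z) (sym (cong suc (ℕ.m∸n+n≡m s≤k)))
    raised : ∀ {z} → pw S ∣ₛ z → pw (suc e ℕ.+ s) ∣ₛ z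
    raised = retype ∘ ∣ₛ-trans (pw-mono k<S)
    split : ∀ {z} → pw S ∣ₛ z → pw (s ℕ.+ (S ∸ s)) ∣ₛ z
    split {z} = subst (λ l → pw l ∣ₛ z) (sym (ℕ.m+[n∸m]≡n (ℕ.≤-trans s≤k (ℕ.<⇒≤ k<S))))
    lowered : ∀ {y z} → (pw (suc e ℕ.+ s′) ∣ₛ y → pw (suc e ℕ.+ s′) ∣ₛ z) → pw S ∣ₛ y → pw k ∣ₛ z
    lowered {y} {z} step h = subst (λ l → pw l ∣ₛ z) k≡
      (step (subst (λ l → pw l ∣ₛ y) (sym k≡) (∣ₛ-trans (pw-mono (ℕ.<⇒≤ k<S)) h)))
    sp≤m : s ℕ.* p ≤ m
    sp≤m = Monic.degree-bound m a s s≤p hf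
    sp≤n : s ℕ.* p ≤ n
    sp≤n = Monic.degree-bound n b s s≤p hg
    p≤sp : p ≤ s ℕ.* p
    p≤sp = ℕ.m≤m+n p (s′ ℕ.* p)
    p<m+n : p < m ℕ.+ n
    p<m+n = ℕ.<-≤-trans (ℕ.m<m+n p (ℕ.<-≤-trans 0<p (ℕ.≤-trans p≤sp sp≤n)))
      (ℕ.+-monoˡ-≤ n (ℕ.≤-trans p≤sp sp≤m))

  -- Both parameters of `nodes` are x₀, which makes the congruence trivial; the only gain is S - s
  -- at column 0.
  lower-bound : ∀ m n a b s S {v} x₀ → s ≤ p → s ≤ S →
    (∀ x → pw s ∣ₛ eval m a x) → (∀ x → pw s ∣ₛ eval n b x) →
    pw S ∣ₛ eval m a x₀ → pw S ∣ₛ eval n b x₀ →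
    ¬ (pw (suc v) ∣ₛ resultant m n a b) →
    p ℕ.* s ℕ.* s ℕ.+ (S ∸ s) ≤ v
  lower-bound m n a b s S {v} x₀ s≤p s≤S hf hg fS gS ∤ =
    ℕ.≤-trans (ℕ.+-monoʳ-≤ (p ℕ.* s ℕ.* s) gain)
      (valuation-bound m n a b (nodes x₀ x₀) s (first (S ∸ s))
        (Monic.degree-bound m a s s≤p hf) (Monic.degree-bound n b s s≤p hg)
        (Monic.weights-first m a s s≤p hf x₀ x₀ p∣0 (S ∸ s) (split fS))
        (Monic.weights-first n b s s≤p hg x₀ x₀ p∣0 (S ∸ s) (split gS)) ∤)
    where
    split : ∀ {z} → pw S ∣ₛ z → pw (s ℕ.+ (S ∸ s)) ∣ₛ z
    split {z} = subst (λ l → pw l ∣ₛ z) (sym (ℕ.m+[n∸m]≡n s≤S))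
    p∣0 : + p ∣ₛ x₀ - x₀
    p∣0 = subst (+ p ∣ₛ_) (x-x x₀) (∣0 (+ p))
      where
      x-x : ∀ x → 0ℤ ≡ x - x
      x-x = solve-∀
    gain : S ∸ s ≤ sum< (first (S ∸ s)) (m ℕ.+ n)
    -- Column 0 exists only if m + n > 0, which follows from p dividing a value when S > 0; for S =
    -- 0 there is no gain.
    gain with S ℕ.≟ 0
    ... | yes refl = subst (_≤ sum< (first (0 ∸ s)) (m ℕ.+ n)) (sym (ℕ.0∸n≡0 s)) z≤n
    ... | no  S≢0  = sum-first (S ∸ s) (ℕ.<-≤-trans
          (Monic.degree-positive m a s {ℕ.pred S} x₀ (subst (λ l → pw l ∣ₛ eval m a x₀) (sym (ℕ.suc-pred S {{ℕ.≢-nonZero S≢0}})) fS))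
          (ℕ.m≤m+n m n))

-- From divisibility to valuations of the gcd

theorem6 : (p : ℕ) → Prime p →
    (m n : ℕ) (a : Fin m → ℤ) (b : Fin n → ℤ) →
    resultant m n a b ≢ 0ℤ →
    (s : ℕ) → s ≤ p →
    ((x : ℤ) → + (p Data.Nat.^ s) ∣ eval m a x) →
    ((x : ℤ) → + (p Data.Nat.^ s) ∣ eval n b x) →
    (vr : ℕ) → IsVal p (resultant m n a b) vr →
    (S : ℕ) →
    Σ ℤ (λ x → IsVal p (gcd (eval m a x) (eval n b x)) S) →
    ((x : ℤ) (k : ℕ) → IsVal p (gcd (eval m a x) (eval n b x)) k → k ≤ S) →
    ((+ (p Data.Nat.* s Data.Nat.* s) - + s) ≤ℤ (+ vr - + S))
    × ((+ vr - + S ≡ + (p Data.Nat.* s Data.Nat.* s) - + s) →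
    (k : ℕ) → s ≤ k → k ≤ S →
    Σ ℤ (λ x → IsVal p (gcd (eval m a x) (eval n b x)) k))
theorem6 p p-prime m n a b _ s s≤p hf hg vr vr-val S (x₀ , S-val) _ = part-a , part-b
  where
  open Powers p
  open Nodes p p-prime
  open IsVal

  common-divisor : ∀ x k → + (p ℕ.^ k) ∣ eval m a x → + (p ℕ.^ k) ∣ eval n b x →
    + (p ℕ.^ k) ∣ gcd (eval m a x) (eval n b x)
  common-divisor x k = gcd-greatest {eval m a x} {eval n b x} {+ (p ℕ.^ k)}

  divides-left : ∀ x k → + (p ℕ.^ k) ∣ gcd (eval m a x) (eval n b x) → pw k ∣ₛ eval m a x
  divides-left x k h = ∣ᵤ⇒∣ (ℕ∣.∣-trans h (gcd[i,j]∣i (eval m a x) (eval n b x)))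

  divides-right : ∀ x k → + (p ℕ.^ k) ∣ gcd (eval m a x) (eval n b x) → pw k ∣ₛ eval n b x
  divides-right x k h = ∣ᵤ⇒∣ (ℕ∣.∣-trans h (gcd[i,j]∣j (eval m a x) (eval n b x)))

  s≤S : s ≤ S
  s≤S with s ℕ.≤? S
  ... | yes s≤S = s≤S
  ... | no  s≰S = contradiction
        (ℕ∣.∣-trans (∣⇒∣ᵤ (pw-mono (ℕ.≰⇒> s≰S))) (common-divisor x₀ s (hf x₀) (hg x₀)))
        (not-dvd S-val)

  vr-∤ : ¬ (pw (suc vr) ∣ₛ resultant m n a b)
  vr-∤ h = not-dvd vr-val (∣⇒∣ᵤ h)

  -- Adding s clears the truncated `S ∸ s`, so the bounds on natural numbers can be compared with
  -- the integer differences.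
  add-s : ∀ c → p ℕ.* s ℕ.* s ℕ.+ (S ∸ s ℕ.+ c) ℕ.+ s ≡ p ℕ.* s ℕ.* s ℕ.+ S ℕ.+ c
  add-s c = trans (move (p ℕ.* s ℕ.* s) (S ∸ s) c s)
    (cong (λ t → p ℕ.* s ℕ.* s ℕ.+ t ℕ.+ c) (ℕ.m∸n+n≡m s≤S))
    where
    move : ∀ q d c s → q ℕ.+ (d ℕ.+ c) ℕ.+ s ≡ q ℕ.+ (d ℕ.+ s) ℕ.+ c
    move = ℕSolver.solve-∀

  swap-S : ∀ q S s → q + S - (S + s) ≡ q - s
  swap-S = solve-∀

  swap-s : ∀ v S s → v + s - (S + s) ≡ v - S
  swap-s = solve-∀

  part-a : + (p ℕ.* s ℕ.* s) - + s ≤ℤ + vr - + S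
  part-a = subst₂ _≤ℤ_ (swap-S (+ (p ℕ.* s ℕ.* s)) (+ S) (+ s)) (swap-s (+ vr) (+ S) (+ s))
    (ℤ.+-monoˡ-≤ (- (+ S + + s)) (+≤+ bound))
    where
    bound : p ℕ.* s ℕ.* s ℕ.+ S ≤ vr ℕ.+ s
    bound = subst (_≤ vr ℕ.+ s)
      (trans (cong (λ d → p ℕ.* s ℕ.* s ℕ.+ d ℕ.+ s) (sym (ℕ.+-identityʳ (S ∸ s))))
        (trans (add-s 0) (ℕ.+-identityʳ (p ℕ.* s ℕ.* s ℕ.+ S))))
      (ℕ.+-monoˡ-≤ s (lower-bound m n a b s S x₀ s≤p s≤S (∣ᵤ⇒∣ ∘ hf) (∣ᵤ⇒∣ ∘ hg)
        (divides-left x₀ S (pow-dvd S-val)) (divides-right x₀ S (pow-dvd S-val)) vr-∤))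

  part-b : + vr - + S ≡ + (p ℕ.* s ℕ.* s) - + s → ∀ k → s ≤ k → k ≤ S →
    Σ ℤ (λ x → IsVal p (gcd (eval m a x) (eval n b x)) k)
  part-b equality k s≤k k≤S with k ℕ.≟ S
  ... | yes refl = x₀ , S-val
  ... | no  k≢S  with close-point m n a b s k S x₀ s≤p s≤k (ℕ.≤∧≢⇒< k≤S k≢S) (∣ᵤ⇒∣ ∘ hf) (∣ᵤ⇒∣ ∘ hg)
                        (divides-left x₀ S (pow-dvd S-val)) (divides-right x₀ S (pow-dvd S-val)) vr-∤
  ...   | x , (fx , gx) , excess = x , record
          { pow-dvd = common-divisor x k (∣⇒∣ᵤ fx) (∣⇒∣ᵤ gx)
          -- Otherwise p s² + S + 1 ≤ v(r) + s, while the equality says v(r) + s = p s² + S.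
          ; not-dvd = λ h → ℕ.<⇒≱ (ℕ.n<1+n (p ℕ.* s ℕ.* s ℕ.+ S)) (too-large
              (excess (divides-left x (suc k) h) (divides-right x (suc k) h)))
          }
    where
    vr+s≡ : vr ℕ.+ s ≡ p ℕ.* s ℕ.* s ℕ.+ S
    vr+s≡ = ℤ.+-injective (trans (sym (restore (+ vr) (+ S) (+ s)))
      (trans (cong (λ z → z + (+ S + + s)) equality) (restore′ (+ (p ℕ.* s ℕ.* s)) (+ S) (+ s))))
      where
      restore : ∀ v S s → (v - S) + (S + s) ≡ v + s
      restore = solve-∀
      restore′ : ∀ q S s → (q - s) + (S + s) ≡ q + S
      restore′ = solve-∀
    too-large : p ℕ.* s ℕ.* s ℕ.+ (S ∸ s ℕ.+ 1) ≤ vr → suc (p ℕ.* s ℕ.* s ℕ.+ S) ≤ p ℕ.* s ℕ.* s ℕ.+ S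
    too-large h = subst₂ _≤_ (trans (add-s 1) (ℕ.+-comm (p ℕ.* s ℕ.* s ℕ.+ S) 1)) vr+s≡ (ℕ.+-monoˡ-≤ s h)
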